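{- Let $e\ge 3$ be an odd integer, $q=2^e$, and let $\mathcal{V}^3_{\varepsilon}\subset \mathrm{PG}(3,q^2)$ be the hypersurface defined in the context (with $r=3$). Then its number of $\mathbb{F}_{q^2}$-rational points is $$|\mathcal{V}^3_{\varepsilon}|=\begin{cases} q^5+q^2+1 & \text{if } e\equiv 1 \pmod 4,\\ q^5+3q^2+1 & \text{if } e\equiv 3 \pmod 4.\end{cases}$$
   Context: Let $e\ge 3$ be odd, $q=2^e$, $r\ge 2$. Points of $\mathrm{PG}(r,q^2)$ (projective space of projective dimension $r$ over $\mathbb{F}_{q^2}$) have homogeneous coordinates $(X_0,\dots,X_r)$; $\Pi_\infty$ is the hyperplane $X_0=0$, and affine coordinates on the complement $\mathrm{AG}(r,q^2)$ are $x_i=X_i/X_0$. For an exponent involving $\sigma$, $\sigma$ stands for $2^{(e+1)/2}$, i.e. $x^{\sigma}=x^{2^{(e+1)/2}}$ and $x^{\sigma+2}=x^{2^{(e+1)/2}+2}$. Fix $\varepsilon\in\mathbb{F}_{q^2}\setminus\mathbb{F}_q$ such that $\varepsilon^2+\varepsilon+\delta=0$ for some $\delta\in\mathbb{F}_q\setminus\{1\}$ with absolute trace $\mathrm{Tr}_{q/2}(\delta)=\sum_{i=0}^{e-1}\delta^{2^i}=1$. Put $$\Gamma_{\varepsilon}(x)=[x+(x^q+x)\varepsilon]^{\sigma+2}+(x^q+x)^{\sigma}+(x^{2q}+x^2)\varepsilon+x^{q+1}+x^2.$$ $\mathcal{V}^r_\varepsilon$ is the projective hypersurface of $\mathrm{PG}(r,q^2)$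 with affine equation $x_r^q+x_r=\Gamma_{\varepsilon}(x_1)+\dots+\Gamma_{\varepsilon}(x_{r-1})$, i.e. the zero locus of the homogenization (with respect to $X_0$) of the corresponding polynomial; it is identified with its set of $\mathbb{F}_{q^2}$-rational points. -}

module Defs where

open import Algebra.Bundles using (CommutativeRing; RawRing; Semiring)
import Algebra.Definitions
import Algebra.Definitions.RawSemiring
open import Data.Fin.Base using (Fin; zero; suc; toℕ; fromℕ; inject₁)
open import Data.Fin.Properties using (inj⇒≟)
open import Data.List.Base as List using (List; []; _∷_; _++_)
open import Data.Nat.Base as ℕ using (ℕ; zero; suc; _⊔_; _∸_; _/_)
import Data.Nat.Properties as ℕ
open import Data.Product.Base using (Σ; ∃-syntax; _×_; _,_; proj₁; proj₂)
open import Data.Vec.Base as Vec using (Vec; _∷_)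
import Data.Vec.Properties as Vec
open import Data.Vec.Functional using (Vector)
open import Function.Base using (_∘_)
open import Function.Bundles using (Inverse)
open import Function.Properties.Inverse using (Inverse⇒Injection)
open import Level as L using (Level)
open import Relation.Binary.Bundles using (Setoid)
import Relation.Binary.Construct.On as On
open import Relation.Binary.Definitions using (Decidable)
import Relation.Binary.PropositionalEquality.Properties as ≡
open import Relation.Nullary.Decidable using (¬?)
open import Relation.Nullary.Negation using (¬_)

private
  variable
    a c ℓ : Level
    n r : ℕ

HasCardinality : Setoid a ℓ → ℕ → Set (a L.⊔ ℓ)
HasCardinality S n = Inverse S (≡.setoid (Fin n))

record Field c ℓ : Set (L.suc (c L.⊔ ℓ)) where
  field
    commutativeRing : CommutativeRing c ℓ

  open CommutativeRing commutativeRing public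

  field
    1≉0 : 1# ≉ 0#
    inv : ∀ x → x ≉ 0# → Algebra.Definitions.Invertible _≈_ 1# _*_ x

  open Algebra.Definitions.RawSemiring (Semiring.rawSemiring semiring) public
    using (_^_; sum; product)

  -- The fixed points of x ↦ x ^ q; in a field with q² elements these form
  -- the subfield 𝔽_q.
  InSubfield : ℕ → Carrier → Set ℓ
  InSubfield q x = x ^ q ≈ x

  -- Absolute trace of 𝔽_{2^e}, evaluated in the ambient field.
  trace : ℕ → Carrier → Carrier
  trace e x = sum {e} (λ i → x ^ (2 ℕ.^ toℕ i))

module Polynomial (R : CommutativeRing c ℓ)
                  (_≟_ : Decidable (CommutativeRing._≈_ R)) where

  open CommutativeRing R
  open Algebra.Definitions.RawSemiring (Semiring.rawSemiring semiring)
    using (_^_; product)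

  Term : ℕ → Set c
  Term n = Carrier × Vec ℕ n

  -- A formal sum of terms. Exponent vectors may be repeated and coefficients
  -- may vanish or cancel; `support` discards the terms whose monomial has
  -- total coefficient zero, so that the degree is that of the polynomial.
  Poly : ℕ → Set c
  Poly n = List (Term n)

  coefficient : Poly n → Vec ℕ n → Carrier
  coefficient p α =
    List.foldr _+_ 0#
      (List.map proj₁ (List.filter (λ t → Vec.≡-dec ℕ._≟_ (proj₂ t) α) p))

  constant : Carrier → Poly n
  constant x = (x , Vec.replicate _ 0) ∷ []

  var : Fin n → Poly n
  var i = (1# , Vec.replicate _ 0 Vec.[ i ]≔ 1) ∷ []

  polyRing : ℕ → RawRing c ℓ
  polyRing n = record
    { Carrier = Poly n
    ; _≈_     = λ p p′ → ∀ α → coefficient p α ≈ coefficient p′ α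
    ; _+_     = _++_
    ; _*_     = List.cartesianProductWith
                  (λ (x , α) (y , β) → x * y , Vec.zipWith ℕ._+_ α β)
    ; -_      = List.map (λ (x , α) → - x , α)
    ; 0#      = []
    ; 1#      = constant 1#
    }

  eval : Poly n → Vector Carrier n → Carrier
  eval p v =
    List.foldr _+_ 0#
      (List.map (λ (x , α) → x * product (λ i → v i ^ Vec.lookup α i)) p)

  support : Poly n → Poly n
  support p = List.filter (λ t → ¬? (coefficient p (proj₂ t) ≟ 0#)) p

  -- Total degree, with degree 0 for the zero polynomial.
  degree : Poly n → ℕ
  degree p = List.foldr _⊔_ 0 (List.map (Vec.sum ∘ proj₂) (support p))

  -- The new variable has index zero; the old variable i becomes suc i.
  homogenize : Poly n → Poly (suc n)
  homogenize p =
    List.map (λ (x , α) → x , (degree p ∸ Vec.sum α) ∷ α) (support p)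

module Projective (F : Field c ℓ) where

  open Field F

  Nonzero : Vector Carrier n → Set ℓ
  Nonzero v = ¬ (∀ i → v i ≈ 0#)

  Proportional : Vector Carrier n → Vector Carrier n → Set (c L.⊔ ℓ)
  Proportional v w = ∃[ k ] k ≉ 0# × (∀ i → v i ≈ k * w i)

  PG : ℕ → Setoid (c L.⊔ ℓ) (c L.⊔ ℓ)
  PG r = record
    { Carrier       = Σ (Vector Carrier (suc r)) Nonzero
    ; _≈_           = λ P Q → Proportional (proj₁ P) (proj₁ Q)
    ; isEquivalence = record
      { refl  = 1# , 1≉0 , λ i → sym (*-identityˡ _)
      ; sym   = symmetric
      ; trans = transitive
      }
    }
    where
    open import Relation.Binary.Reasoning.Setoid setoid

    cancel : ∀ {x y} → x * y ≈ 1# → ∀ z → x * (y * z) ≈ z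
    cancel {x} {y} xy≈1 z = begin
      x * (y * z) ≈⟨ *-assoc x y z ⟨
      x * y * z   ≈⟨ *-congʳ xy≈1 ⟩
      1# * z      ≈⟨ *-identityˡ z ⟩
      z           ∎

    symmetric : ∀ {v w : Vector Carrier (suc r)} →
                Proportional v w → Proportional w v
    symmetric {v} {w} (k , k≉0 , v≈kw) with inv k k≉0
    ... | k⁻¹ , k⁻¹k≈1 , _ =
      k⁻¹ ,
      (λ k⁻¹≈0 → 1≉0 (trans (sym k⁻¹k≈1) (trans (*-congʳ k⁻¹≈0) (zeroˡ k)))) ,
      λ i → begin
        w i             ≈⟨ cancel k⁻¹k≈1 (w i) ⟨
        k⁻¹ * (k * w i) ≈⟨ *-congˡ (v≈kw i) ⟨
        k⁻¹ * v i       ∎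

    transitive : ∀ {u v w : Vector Carrier (suc r)} →
                 Proportional u v → Proportional v w → Proportional u w
    transitive {u} {v} {w} (k , k≉0 , u≈kv) (l , l≉0 , v≈lw) with inv k k≉0
    ... | k⁻¹ , k⁻¹k≈1 , _ =
      k * l ,
      (λ kl≈0 → l≉0 (trans (sym (cancel k⁻¹k≈1 l))
                           (trans (*-congˡ kl≈0) (zeroʳ k⁻¹)))) ,
      λ i → begin
        u i           ≈⟨ u≈kv i ⟩
        k * v i       ≈⟨ *-congˡ (v≈lw i) ⟩
        k * (l * w i) ≈⟨ *-assoc k l (w i) ⟨
        k * l * w i   ∎

module _ (R : RawRing c ℓ) where

  open RawRing R
  open Algebra.Definitions.RawSemiring rawSemiring using (_^_)

  -- The expression Γ_ε(x), with q = 2^e and σ = 2^((e+1)/2), in any ring.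
  Γ : ℕ → Carrier → Carrier → Carrier
  Γ e ε x =
    (x + (x ^ q + x) * ε) ^ (σ ℕ.+ 2)
      + (x ^ q + x) ^ σ
      + (x ^ (2 ℕ.* q) + x ^ 2) * ε
      + x ^ (q ℕ.+ 1)
      + x ^ 2
    where
    q σ : ℕ
    q = 2 ℕ.^ e
    σ = 2 ℕ.^ ((e ℕ.+ 1) / 2)

module Hypersurface (F : Field c ℓ) {N : ℕ}
                    (finite : HasCardinality (Field.setoid F) N) where

  open Field F
  open Projective F
  open Polynomial commutativeRing (inj⇒≟ (Inverse⇒Injection finite))

  -- Only meaningful for homogeneous h, where vanishing does not depend on the
  -- representative of the point.
  zeroLocus : Poly (suc r) → Setoid (c L.⊔ ℓ) (c L.⊔ ℓ)
  zeroLocus {r} h =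
    On.setoid {B = ∃[ P ] eval h (proj₁ P) ≈ 0#} (PG r) proj₁

  -- x_r^q + x_r - (Γ_ε(x_1) + … + Γ_ε(x_{r-1})) with r = suc m: the variable
  -- of index i : Fin (suc m) is x_{i+1}, so the last one is x_r.
  affineEquation : (e : ℕ) (ε : Carrier) (m : ℕ) → Poly (suc m)
  affineEquation e ε m =
    (xᵣ ^ₚ (2 ℕ.^ e) +ₚ xᵣ)
      +ₚ -ₚ sumₚ (λ (i : Fin m) →
              Γ (polyRing (suc m)) e (constant ε) (var (inject₁ i)))
    where
    open RawRing (polyRing (suc m)) using (rawSemiring)
      renaming (_+_ to _+ₚ_; -_ to -ₚ_)
    open Algebra.Definitions.RawSemiring rawSemiring
      renaming (_^_ to _^ₚ_; sum to sumₚ)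
    xᵣ : Poly (suc m)
    xᵣ = var (fromℕ m)

  -- 𝒱 e ε m is the set of rational points of 𝒱^{m+1}_ε in PG(m+1, q²).
  𝒱 : (e : ℕ) (ε : Carrier) (m : ℕ) → Setoid (c L.⊔ ℓ) (c L.⊔ ℓ)
  𝒱 e ε m = zeroLocus (homogenize (affineEquation e ε m))

module Submission where

open import Defs
open import Algebra.Bundles using (CommutativeRing; RawRing; Semiring)
import Algebra.Definitions.RawSemiring
import Algebra.Properties.CommutativeMonoid.Sum
import Algebra.Properties.CommutativeSemigroup
import Algebra.Properties.CommutativeSemiring.Exp
import Algebra.Properties.Group
import Algebra.Properties.Ring
import Algebra.Properties.Semiring.Mult
import Algebra.Solver.Ring
import Algebra.Solver.Ring.AlmostCommutativeRing as ACR
open import Data.Bool.Base using (Bool; true; false; if_then_else_; _xor_; _∧_)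
import Data.Bool.Properties as Bool
open import Data.Fin.Base using (Fin; zero; suc; punchIn; toℕ)
open import Data.Fin.Patterns using (0F; 1F; 2F; 3F)
import Data.Fin.Permutation as Perm
import Data.Fin.Properties as Fin
open import Data.List.Base as List using ([]; _∷_; _++_)
import Data.List.Properties as List
open import Data.List.Relation.Unary.All as All using (All; []; _∷_)
import Data.List.Relation.Unary.All.Properties as All
open import Data.Maybe.Base using (just; nothing)
open import Data.Nat.Base as ℕ
  using (ℕ; zero; suc; _⊔_; _∸_; _≤_; _<_; _/_; _%_; z≤n; s≤s; z<s; s<s)
import Data.Nat.DivMod as ℕ
import Data.Nat.Properties as ℕ
import Data.Nat.Solver
open import Data.Product.Base using (_×_; _,_; proj₁; proj₂; ∃; ∃-syntax)
open import Data.Product.Function.NonDependent.Setoid using (_×-inverse_)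
import Data.Product.Relation.Binary.Pointwise.NonDependent as Product
open import Data.Sum.Base using (_⊎_; inj₁; inj₂; [_,_]′)
open import Data.Sum.Function.Setoid using (_⊎-inverse_)
import Data.Sum.Relation.Binary.Pointwise as Sum
open import Data.Vec.Base as Vec using (Vec; []; _∷_)
open import Data.Vec.Functional as Vector using (Vector)
import Data.Vec.Properties as Vec
open import Function.Base using (_∘_; id)
open import Function.Bundles using (Inverse; Equivalence; _⇔_; mk⇔)
open import Function.Consequences.Setoid using (strictlySurjective⇒surjective)
import Function.Construct.Composition as Composition
import Function.Construct.Symmetry as Symmetry
open import Function.Definitions using (Congruent; Injective; StrictlySurjective)
open import Function.Properties.Bijection using (Bijection⇒Inverse)
open import Function.Properties.Inverse using (Inverse⇒Injection)
open import Level as L using (Level)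
open import Relation.Binary.Bundles using (Setoid)
import Relation.Binary.Construct.On as On
open import Relation.Binary.Definitions using (Decidable; WeaklyDecidable; _Respects_)
open import Relation.Binary.PropositionalEquality.Core as ≡ using (_≡_; _≢_)
import Relation.Binary.PropositionalEquality.Properties as ≡
open import Relation.Nullary.Decidable using (Dec; yes; no; ¬?; does; dec-true; dec-false)
open import Relation.Nullary.Negation using (¬_; contradiction)

-- Write Tr x = x ^ q + x. As Tr ε = 1, both x₁ = Tr x and x₀ = x + ε * x₁ lie in
-- 𝔽_q, and Γ_ε(x) = x₀ ^ (σ + 2) + x₁ ^ σ + x₀ * x₁ lies there as well. The affine
-- equation Tr x₃ = Γ_ε(x₁) + Γ_ε(x₂) therefore has exactly the solutions
-- x₃ = z + ε * (Γ_ε(x₁) + Γ_ε(x₂)) with z ∈ 𝔽_q, which gives q ^ 5 affine points.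
-- The homogeneous component of highest degree of the equation is
-- ε ^ (σ + 2) * (X₁ ^ q(σ + 2) + X₂ ^ q(σ + 2)), so the points at infinity form a
-- cone with vertex (0 : 0 : 0 : 1) over the solutions of y ^ (σ + 2) = 1. With
-- e = 2k + 1 such a y satisfies y ^ 2^k = y⁻¹, hence y ^ 4 = y; thus y = 1 if k is
-- even and y ^ 3 = 1 if k is odd. Three cube roots of unity exist because the
-- half-trace of δ corrects ε to a root of X² + X + 1.

-- The obstacle is the homogenization. `e` is a variable, so the equation of degree (σ + 2) * q
-- cannot be expanded, yet `degree` and `homogenize` refer to the coefficients left after
-- cancellation. The proof therefore never computes a coefficient. `HasForm` follows the
-- construction of the polynomial and records only values, keeping terms that cancel. This is sound
-- because a sum weighted by exponents does not see terms of total coefficient zero. The degree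
-- itself then comes from a single nonzero value of the top component. The field is likewise known
-- only through an enumeration of its elements: x ^ (q ^ 2) = x and characteristic two come from
-- reindexing a product and a sum over all elements, and |𝔽_q| = q comes from writing the field as
-- 𝔽_q + ε * 𝔽_q.

module PowerProperties {c ℓ} (R : CommutativeRing c ℓ) where

  open CommutativeRing R hiding (zero)
  open Algebra.Definitions.RawSemiring (Semiring.rawSemiring semiring)
    using (_^_)

  1^ : ∀ k {x} → x ≈ 1# → x ^ k ≈ 1#
  1^ zero    x≈1 = refl
  1^ (suc k) x≈1 = trans (*-cong x≈1 (1^ k x≈1)) (*-identityˡ 1#)

  0^ : ∀ {k x} → 0 < k → x ≈ 0# → x ^ k ≈ 0#
  0^ {suc k} _ x≈0 = trans (*-congʳ x≈0) (zeroˡ _)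

-- Values, degree and homogenization of formal polynomials.

module PolynomialProperties {c ℓ} (R : CommutativeRing c ℓ)
                            (_≟_ : Decidable (CommutativeRing._≈_ R)) where

  open CommutativeRing R hiding (zero)
  open Algebra.Definitions.RawSemiring (Semiring.rawSemiring semiring)
    using (_^_; product)
  open Algebra.Properties.CommutativeMonoid.Sum *-commutativeMonoid
    using () renaming (∑-distrib-+ to product-distrib-*; sum-cong-≋ to product-cong)
  open Algebra.Properties.CommutativeSemiring.Exp commutativeSemiring
    using (^-homo-*; ^-distrib-*; ^-congˡ; ^-congʳ)
  open Algebra.Properties.Ring ring using (-‿+-comm; -‿distribˡ-*; -0#≈0#)
  open Algebra.Properties.CommutativeSemigroup *-commutativeSemigroup
    using (interchange)
  open import Relation.Binary.Reasoning.Setoid setoid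
  open Polynomial R _≟_
  open PowerProperties R

  private
    variable
      n D D′ : ℕ

    _≟ᵥ_ : Decidable {A = Vec ℕ n} _≡_
    _≟ᵥ_ = Vec.≡-dec ℕ._≟_

  -- `eval` and `form` are both of this shape, with a weight that depends on the exponent vector
  -- alone, so what holds for arbitrary `g` serves both.
  weighted : (Vec ℕ n → Carrier) → Poly n → Carrier
  weighted g p = List.foldr _+_ 0# (List.map (λ (x , α) → x * g α) p)

  weighted-++ : ∀ (g : Vec ℕ n → Carrier) p p′ →
                weighted g (p ++ p′) ≈ weighted g p + weighted g p′
  weighted-++ g []            p′ = sym (+-identityˡ _)
  weighted-++ g ((x , α) ∷ p) p′ =
    trans (+-congˡ (weighted-++ g p p′)) (sym (+-assoc _ _ _))

  weighted-cong : ∀ {g h : Vec ℕ n → Carrier} p →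
                  All (λ (_ , α) → g α ≈ h α) p → weighted g p ≈ weighted h p
  weighted-cong []      []       = refl
  weighted-cong (_ ∷ p) (e ∷ es) = +-cong (*-congˡ e) (weighted-cong p es)

  weighted-* : ∀ (g : Vec ℕ n → Carrier) k p →
               weighted (λ α → k * g α) p ≈ k * weighted g p
  weighted-* g k []            = sym (zeroʳ k)
  weighted-* g k ((x , α) ∷ p) = begin
    x * (k * g α) + weighted (λ α → k * g α) p ≈⟨ +-cong (sym (*-assoc _ _ _)) (weighted-* g k p) ⟩
    x * k * g α + k * weighted g p             ≈⟨ +-congʳ (*-congʳ (*-comm x k)) ⟩
    k * x * g α + k * weighted g p             ≈⟨ +-congʳ (*-assoc k x _) ⟩
    k * (x * g α) + k * weighted g p           ≈⟨ distribˡ k _ _ ⟨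
    k * (x * g α + weighted g p)               ∎

  -- Terms are switched off through the weight instead of being removed from the list, so that
  -- inductions keep running over the same `p`.
  restrict : (Vec ℕ n → Bool) → (Vec ℕ n → Carrier) → Vec ℕ n → Carrier
  restrict b g α = if b α then g α else 0#

  coefficient-∷ : ∀ x (β : Vec ℕ n) p α →
    coefficient ((x , β) ∷ p) α ≈ (if does (β ≟ᵥ α) then x else 0#) + coefficient p α
  coefficient-∷ x β p α with does (β ≟ᵥ α)
  ... | true  = refl
  ... | false = sym (+-identityˡ _)

  weighted-split : ∀ (g : Vec ℕ n → Carrier) α p →
    weighted g p ≈ coefficient p α * g α + weighted (restrict (λ β → does (¬? (β ≟ᵥ α))) g) p
  weighted-split g α [] = sym (trans (+-identityʳ _) (zeroˡ _))
  weighted-split g α ((x , β) ∷ p) with β ≟ᵥ α | weighted-split g α p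
  ... | yes ≡.refl | ih = begin
    x * g α + weighted g p                       ≈⟨ +-congˡ ih ⟩
    x * g α + (coefficient p α * g α + W)        ≈⟨ +-assoc _ _ _ ⟨
    x * g α + coefficient p α * g α + W          ≈⟨ +-cong (distribʳ _ _ _) (+-identityˡ W) ⟨
    (x + coefficient p α) * g α + (0# + W)       ≈⟨ +-congˡ (+-congʳ (zeroʳ x)) ⟨
    (x + coefficient p α) * g α + (x * 0# + W)   ∎
    where W = weighted (restrict (λ β → does (¬? (β ≟ᵥ α))) g) p
  ... | no _ | ih = begin
    x * g β + weighted g p                ≈⟨ +-congˡ ih ⟩
    x * g β + (C + W)                     ≈⟨ +-assoc _ _ _ ⟨
    x * g β + C + W                       ≈⟨ +-congʳ (+-comm _ _) ⟩
    C + x * g β + W                       ≈⟨ +-assoc _ _ _ ⟩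
    C + (x * g β + W)                     ∎
    where
    C = coefficient p α * g α
    W = weighted (restrict (λ β → does (¬? (β ≟ᵥ α))) g) p

  -- Once the terms with the exponent α of the head have been collected, g may be
  -- replaced by 0# at α.
  weighted-vanishing : ∀ (g : Vec ℕ n → Carrier) p →
    (∀ α → coefficient p α * g α ≈ 0#) → weighted g p ≈ 0#
  weighted-vanishing g []            _  = refl
  weighted-vanishing g ((x , α) ∷ p) cg = begin
    x * g α + weighted g p                  ≈⟨ +-congˡ (weighted-split g α p) ⟩
    x * g α + (coefficient p α * g α + weighted g′ p)
                                            ≈⟨ +-assoc _ _ _ ⟨
    x * g α + coefficient p α * g α + weighted g′ p
                                            ≈⟨ +-cong (sym (distribʳ _ _ _)) (weighted-vanishing g′ p vanish) ⟩
    (x + coefficient p α) * g α + 0#        ≈⟨ +-identityʳ _ ⟩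
    (x + coefficient p α) * g α             ≈⟨ *-congʳ (reflexive head-coefficient) ⟨
    coefficient ((x , α) ∷ p) α * g α       ≈⟨ cg α ⟩
    0#                                      ∎
    where
    g′ = restrict (λ β → does (¬? (β ≟ᵥ α))) g

    head-coefficient : coefficient ((x , α) ∷ p) α ≡ x + coefficient p α
    head-coefficient rewrite dec-true (α ≟ᵥ α) ≡.refl = ≡.refl

    vanish : ∀ β → coefficient p β * g′ β ≈ 0#
    vanish β with β ≟ᵥ α
    ... | yes _  = zeroʳ _
    ... | no β≢α = trans (*-congʳ (sym eq)) (cg β)
      where
      eq : coefficient ((x , α) ∷ p) β ≈ coefficient p β
      eq = trans (coefficient-∷ x α p β)
        (trans (+-congʳ (reflexive (≡.cong (if_then x else 0#)
                 (dec-false (α ≟ᵥ β) (β≢α ∘ ≡.sym)))))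
               (+-identityˡ _))

  weighted-filter : ∀ {Q : Vec ℕ n → Set ℓ} (Q? : ∀ α → Dec (Q α)) (g : Vec ℕ n → Carrier) p →
    weighted g p ≈
    weighted (restrict (does ∘ Q?) g) p + weighted g (List.filter (λ t → ¬? (Q? (proj₂ t))) p)
  weighted-filter Q? g [] = sym (+-identityʳ _)
  weighted-filter Q? g ((x , α) ∷ p) with Q? α | weighted-filter Q? g p
  ... | yes _ | ih = trans (+-congˡ ih) (sym (+-assoc _ _ _))
  ... | no  _ | ih = begin
    x * g α + weighted g p  ≈⟨ +-congˡ ih ⟩
    x * g α + (A + B)       ≈⟨ +-assoc _ _ _ ⟨
    x * g α + A + B         ≈⟨ +-congʳ (+-comm _ _) ⟩
    A + x * g α + B         ≈⟨ +-assoc _ _ _ ⟩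
    A + (x * g α + B)       ≈⟨ +-congʳ (+-identityˡ A) ⟨
    0# + A + (x * g α + B)  ≈⟨ +-congʳ (+-congʳ (zeroʳ x)) ⟨
    x * 0# + A + (x * g α + B) ∎
    where
    A = weighted (restrict (does ∘ Q?) g) p
    B = weighted g (List.filter (λ t → ¬? (Q? (proj₂ t))) p)

  -- The discarded terms are those whose exponent has total coefficient zero. The weight `g₀` lives
  -- on just these exponents, so `coefficient p α * g₀ α` always vanishes and `weighted-vanishing`
  -- applies.
  weighted-support : ∀ (g : Vec ℕ n → Carrier) p →
                     weighted g (support p) ≈ weighted g p
  weighted-support g p = sym (begin
    weighted g p                                 ≈⟨ weighted-filter Q? g p ⟩
    weighted g₀ p + weighted g (support p)       ≈⟨ +-congʳ (weighted-vanishing g₀ p vanish) ⟩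
    0# + weighted g (support p)                  ≈⟨ +-identityˡ _ ⟩
    weighted g (support p)                       ∎)
    where
    Q? = λ α → coefficient p α ≟ 0#
    g₀ = restrict (does ∘ Q?) g
    vanish : ∀ α → coefficient p α * g₀ α ≈ 0#
    vanish α with coefficient p α ≟ 0#
    ... | yes z = trans (*-congʳ z) (zeroˡ _)
    ... | no  _ = zeroʳ _

  Bounded : ℕ → Poly n → Set c
  Bounded D = All (λ (_ , α) → Vec.sum α ≤ D)

  degree≤ : ∀ {p : Poly n} → Bounded D p → degree p ≤ D
  degree≤ {p = p} b = go (All.filter⁺ _ b)
    where
    go : ∀ {p} → Bounded D p → List.foldr _⊔_ 0 (List.map (Vec.sum ∘ proj₂) p) ≤ D
    go []       = z≤n
    go (b ∷ bs) = ℕ.⊔-lub b (go bs)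

  support-bounded : ∀ (p : Poly n) → Bounded (degree p) (support p)
  support-bounded p = go (support p)
    where
    go : ∀ (p : Poly n) → Bounded (List.foldr _⊔_ 0 (List.map (Vec.sum ∘ proj₂) p)) p
    go []      = []
    go (_ ∷ p) = ℕ.m≤m⊔n _ _ ∷ All.map (λ le → ℕ.≤-trans le (ℕ.m≤n⊔m _ _)) (go p)

  monomial : Vector Carrier n → Vec ℕ n → Carrier
  monomial v α = product (λ i → v i ^ Vec.lookup α i)

  form : Carrier → Vector Carrier n → ℕ → Poly n → Carrier
  form t v D = weighted (λ α → t ^ (D ∸ Vec.sum α) * monomial v α)

  -- h is the value at (t, v) of the homogenization of p to degree D, with terms
  -- that cancel retained. For t ≈ 1# this is the value of p at v, for t ≈ 0# that
  -- of its component of degree D.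
  record HasForm (t : Carrier) (v : Vector Carrier n) (D : ℕ) (p : Poly n)
                 (h : Carrier) : Set (c L.⊔ ℓ) where
    constructor _,_
    field
      bounded : Bounded D p
      value   : form t v D p ≈ h

  open HasForm public

  module _ {t : Carrier} {v : Vector Carrier n} where

    HasForm-≈ : ∀ {p h h′} → h ≈ h′ → HasForm t v D p h → HasForm t v D p h′
    HasForm-≈ h≈h′ (b , e) = b , trans e h≈h′

    HasForm-0 : HasForm t v D [] 0#
    HasForm-0 = [] , refl

    HasForm-+ : ∀ {p p′ h h′} → HasForm t v D p h → HasForm t v D p′ h′ →
                HasForm t v D (p ++ p′) (h + h′)
    HasForm-+ {p = p} {p′} (b , e) (b′ , e′) =
      All.++⁺ b b′ , trans (weighted-++ _ p p′) (+-cong e e′)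

    HasForm-neg : ∀ {p h} → HasForm t v D p h →
                  HasForm t v D (RawRing.-_ (polyRing n) p) (- h)
    HasForm-neg {D = D} {p} (b , e) = All.map⁺ b , trans (go p) (-‿cong e)
      where
      go : ∀ p → form t v D (RawRing.-_ (polyRing n) p) ≈ - form t v D p
      go []            = sym -0#≈0#
      go ((x , α) ∷ p) =
        trans (+-cong (sym (-‿distribˡ-* x _)) (go p)) (-‿+-comm _ _)

    -- Slack in the degree bound costs a power of `t`: this is harmless at `1#`, and at `0#` it
    -- annihilates the value as soon as the slack is positive.
    HasForm-lift : ∀ {p h} → D ≤ D′ → HasForm t v D p h →
                   HasForm t v D′ p (t ^ (D′ ∸ D) * h)
    HasForm-lift {D} {D′} {p} D≤D′ (b , e) =
      All.map (λ le → ℕ.≤-trans le D≤D′) b ,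
      trans (weighted-cong p (All.map (λ {(_ , α)} → shift α) b))
            (trans (weighted-* _ _ p) (*-congˡ e))
      where
      shift : ∀ (α : Vec ℕ n) → Vec.sum α ≤ D →
              t ^ (D′ ∸ Vec.sum α) * monomial v α ≈
              t ^ (D′ ∸ D) * (t ^ (D ∸ Vec.sum α) * monomial v α)
      shift α le = trans
        (*-congʳ (trans
          (^-congʳ t (≡.sym (≡.trans (≡.sym (ℕ.+-∸-assoc (D′ ∸ D) le))
                                     (≡.cong (_∸ Vec.sum α) (ℕ.m∸n+n≡m D≤D′)))))
          (^-homo-* t (D′ ∸ D) (D ∸ Vec.sum α))))
        (*-assoc _ _ _)

    HasForm-lift₁ : ∀ {p h} → t ≈ 1# → D ≤ D′ → HasForm t v D p h →
                    HasForm t v D′ p h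
    HasForm-lift₁ {D} {D′} t≈1 le f = HasForm-≈
      (trans (*-congʳ (1^ (D′ ∸ D) t≈1)) (*-identityˡ _)) (HasForm-lift le f)

    HasForm-lift₀ : ∀ {p h} → t ≈ 0# → D < D′ → HasForm t v D p h →
                    HasForm t v D′ p 0#
    HasForm-lift₀ t≈0 lt f = HasForm-≈
      (trans (*-congʳ (0^ (ℕ.m<n⇒0<n∸m lt) t≈0)) (zeroˡ _))
      (HasForm-lift (ℕ.<⇒≤ lt) f)

  private
    sum-zipWith : ∀ (α β : Vec ℕ n) →
                  Vec.sum (Vec.zipWith ℕ._+_ α β) ≡ Vec.sum α ℕ.+ Vec.sum β
    sum-zipWith []      []      = ≡.refl
    sum-zipWith (a ∷ α) (b ∷ β) rewrite sum-zipWith α β =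
      ℕ-interchange a b (Vec.sum α) (Vec.sum β)
      where open Algebra.Properties.CommutativeSemigroup ℕ.+-commutativeSemigroup
              using () renaming (interchange to ℕ-interchange)

    sum-replicate-0 : ∀ n → Vec.sum (Vec.replicate n 0) ≡ 0
    sum-replicate-0 zero    = ≡.refl
    sum-replicate-0 (suc n) = sum-replicate-0 n

    sum-unit : ∀ (i : Fin n) → Vec.sum (Vec.replicate n 0 Vec.[ i ]≔ 1) ≡ 1
    sum-unit {suc n} zero    = ≡.cong suc (sum-replicate-0 n)
    sum-unit {suc n} (suc i) = sum-unit i

    -- Truncated subtraction splits in this way only below the bounds; `bounded` supplies them when
    -- the power of `t` in a product is separated.
    ∸-+-∸ : ∀ {a b D D′} → a ≤ D → b ≤ D′ →
            (D ℕ.+ D′) ∸ (a ℕ.+ b) ≡ (D ∸ a) ℕ.+ (D′ ∸ b)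
    ∸-+-∸ {a} {b} {D} {D′} a≤D b≤D′ = ≡.trans (≡.sym (ℕ.∸-+-assoc (D ℕ.+ D′) a b))
      (≡.trans (≡.cong (_∸ b) (ℕ.+-∸-comm D′ a≤D)) (ℕ.+-∸-assoc (D ∸ a) b≤D′))

  monomial-+ : ∀ (v : Vector Carrier n) α β →
    monomial v (Vec.zipWith ℕ._+_ α β) ≈ monomial v α * monomial v β
  monomial-+ v α β = trans
    (product-cong (λ i → trans
      (^-congʳ (v i) (Vec.lookup-zipWith ℕ._+_ i α β))
      (^-homo-* (v i) (Vec.lookup α i) (Vec.lookup β i))))
    (product-distrib-* (λ i → v i ^ Vec.lookup α i) (λ i → v i ^ Vec.lookup β i))

  monomial-0 : ∀ (v : Vector Carrier n) → monomial v (Vec.replicate n 0) ≈ 1#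
  monomial-0 {zero}  v = refl
  monomial-0 {suc n} v = trans (*-identityˡ _) (monomial-0 (v ∘ suc))

  monomial-unit : ∀ (v : Vector Carrier n) i →
                  monomial v (Vec.replicate n 0 Vec.[ i ]≔ 1) ≈ v i
  monomial-unit {suc n} v zero    = trans (*-congˡ (monomial-0 (v ∘ suc)))
    (trans (*-identityʳ _) (*-identityʳ _))
  monomial-unit {suc n} v (suc i) = trans (*-identityˡ _) (monomial-unit (v ∘ suc) i)

  monomial-scale : ∀ {v w : Vector Carrier n} {k} → (∀ i → v i ≈ k * w i) → ∀ α →
                   monomial v α ≈ k ^ Vec.sum α * monomial w α
  monomial-scale v≈kw []      = sym (*-identityˡ _)
  monomial-scale {w = w} {k} v≈kw (a ∷ α) = begin
    _ ≈⟨ *-cong (trans (^-congˡ a (v≈kw zero)) (^-distrib-* k (w zero) a))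
                (monomial-scale (v≈kw ∘ suc) α) ⟩
    (k ^ a * w zero ^ a) * (k ^ Vec.sum α * monomial (w ∘ suc) α) ≈⟨ interchange _ _ _ _ ⟩
    (k ^ a * k ^ Vec.sum α) * (w zero ^ a * monomial (w ∘ suc) α) ≈⟨ *-congʳ (^-homo-* k a (Vec.sum α)) ⟨
    k ^ (a ℕ.+ Vec.sum α) * (w zero ^ a * monomial (w ∘ suc) α) ∎

  module _ {t : Carrier} {v : Vector Carrier n} where

    open RawRing (polyRing n) using (rawSemiring)
      renaming (_*_ to _*ₚ_)
    open Algebra.Definitions.RawSemiring rawSemiring
      using () renaming (_^_ to _^ₚ_)

    HasForm-constant : ∀ x → HasForm t v 0 (constant x) x
    HasForm-constant x =
      (ℕ.≤-reflexive (sum-replicate-0 n) ∷ []) ,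
      trans (+-identityʳ _) (trans (*-congˡ (trans
        (*-cong (^-congʳ t (ℕ.0∸n≡0 (Vec.sum (Vec.replicate n 0)))) (monomial-0 v))
        (*-identityˡ _))) (*-identityʳ x))

    HasForm-var : ∀ i → HasForm t v 1 (var i) (v i)
    HasForm-var i =
      (ℕ.≤-reflexive (sum-unit i) ∷ []) ,
      trans (+-identityʳ _) (trans (*-identityˡ _)
        (trans (*-cong (^-congʳ t (≡.cong (1 ∸_) (sum-unit i))) (monomial-unit v i)) (*-identityˡ _)))

    HasForm-* : ∀ {p p′ h h′} → HasForm t v D p h → HasForm t v D′ p′ h′ →
                HasForm t v (D ℕ.+ D′) (p *ₚ p′) (h * h′)
    HasForm-* {D} {D′} {p} {p′} (b , e) (b′ , e′) =
      bounded-* p b , trans (form-* p b) (*-cong e e′)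
      where
      term* : Term n → Term n → Term n
      term* (x , α) (y , β) = x * y , Vec.zipWith ℕ._+_ α β

      bounded-* : ∀ p → Bounded D p → Bounded (D ℕ.+ D′) (p *ₚ p′)
      bounded-* [] [] = []
      bounded-* ((x , α) ∷ p) (a ∷ b) = All.++⁺
        (All.map⁺ (All.map (λ {(_ , β)} a′ →
          ℕ.≤-trans (ℕ.≤-reflexive (sum-zipWith α β)) (ℕ.+-mono-≤ a a′)) b′))
        (bounded-* p b)

      step : ∀ x y α β → Vec.sum α ≤ D → Vec.sum β ≤ D′ →
        (x * y) * (t ^ (D ℕ.+ D′ ∸ Vec.sum (Vec.zipWith ℕ._+_ α β))
                    * monomial v (Vec.zipWith ℕ._+_ α β))
        ≈ (x * (t ^ (D ∸ Vec.sum α) * monomial v α)) * (y * (t ^ (D′ ∸ Vec.sum β) * monomial v β))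
      step x y α β a a′ = begin
        _ ≈⟨ *-congˡ (*-cong
               (trans (^-congʳ t (≡.trans (≡.cong (D ℕ.+ D′ ∸_) (sum-zipWith α β)) (∸-+-∸ a a′)))
                      (^-homo-* t (D ∸ Vec.sum α) (D′ ∸ Vec.sum β)))
               (monomial-+ v α β)) ⟩
        (x * y) * ((t ^ (D ∸ Vec.sum α) * t ^ (D′ ∸ Vec.sum β)) * (monomial v α * monomial v β))
          ≈⟨ *-congˡ (interchange _ _ _ _) ⟩
        (x * y) * ((t ^ (D ∸ Vec.sum α) * monomial v α) * (t ^ (D′ ∸ Vec.sum β) * monomial v β))
          ≈⟨ interchange _ _ _ _ ⟩
        _ ∎

      form-term : ∀ x α → Vec.sum α ≤ D → ∀ p′ → Bounded D′ p′ →
        form t v (D ℕ.+ D′) (List.map (term* (x , α)) p′)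
        ≈ (x * (t ^ (D ∸ Vec.sum α) * monomial v α)) * form t v D′ p′
      form-term x α a []             []       = sym (zeroʳ _)
      form-term x α a ((y , β) ∷ p′) (a′ ∷ b′) =
        trans (+-cong (step x y α β a a′) (form-term x α a p′ b′)) (sym (distribˡ _ _ _))

      form-* : ∀ p → Bounded D p →
               form t v (D ℕ.+ D′) (p *ₚ p′) ≈ form t v D p * form t v D′ p′
      form-* []            []      = sym (zeroˡ _)
      form-* ((x , α) ∷ p) (a ∷ b) = begin
        _ ≈⟨ weighted-++ _ (List.map (term* (x , α)) p′) (p *ₚ p′) ⟩
        _ ≈⟨ +-cong (form-term x α a p′ b′) (form-* p b) ⟩
        _ ≈⟨ distribʳ _ _ _ ⟨
        _ ∎

    HasForm-^ : ∀ {p h} k → HasForm t v D p h →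
                HasForm t v (k ℕ.* D) (p ^ₚ k) (h ^ k)
    HasForm-^ zero    f = HasForm-constant 1#
    HasForm-^ (suc k) f = HasForm-* f (HasForm-^ k f)

  -- If the degree were below `D`, every term of the support would carry a positive power of
  -- `t ≈ 0#`, forcing `h` to vanish. One nonzero value thus certifies the degree.
  degree≡ : ∀ {p : Poly n} {t v h} → t ≈ 0# → HasForm t v D p h → h ≉ 0# →
            degree p ≡ D
  degree≡ {D = D} {p} {t} {v} {h} t≈0 f h≉0 =
    ℕ.≤-antisym (degree≤ (bounded f)) (ℕ.≮⇒≥ λ lt → h≉0 (begin
      h                          ≈⟨ value f ⟨
      form t v D p               ≈⟨ weighted-support _ p ⟨
      form t v D (support p)     ≈⟨ value (lift lt) ⟩
      0#                         ∎))
    where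
    lift : degree p < D → HasForm t v D (support p) 0#
    lift lt = HasForm-lift₀ t≈0 lt (support-bounded p , refl)

  -- `homogenize` drops the cancelled terms while `form` keeps them; `weighted-support` reconciles
  -- the two.
  eval-homogenize : ∀ (p : Poly n) w →
    eval (homogenize p) w ≈ form (w zero) (w ∘ suc) (degree p) p
  eval-homogenize p w = trans
    (reflexive (≡.cong (List.foldr _+_ 0#) (≡.sym (List.map-∘ (support p)))))
    (weighted-support _ p)

  eval-homogenize-scale : ∀ {n} (p : Poly n) {v w k} → (∀ i → v i ≈ k * w i) →
    eval (homogenize p) v ≈ k ^ degree p * eval (homogenize p) w
  eval-homogenize-scale {n} p {v} {w} {k} v≈kw = begin
    eval (homogenize p) v ≈⟨ to-form v ⟩
    form (v zero) (v ∘ suc) (degree p) (support p)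
      ≈⟨ weighted-cong (support p) (All.map (λ {(_ , α)} → scale α) (support-bounded p)) ⟩
    weighted (λ α → k ^ degree p * (w zero ^ (degree p ∸ Vec.sum α) * monomial (w ∘ suc) α))
             (support p)
      ≈⟨ weighted-* _ _ (support p) ⟩
    k ^ degree p * form (w zero) (w ∘ suc) (degree p) (support p)
      ≈⟨ *-congˡ (to-form w) ⟨
    k ^ degree p * eval (homogenize p) w ∎
    where
    to-form : ∀ w → eval (homogenize p) w ≈ form (w zero) (w ∘ suc) (degree p) (support p)
    to-form w = reflexive (≡.cong (List.foldr _+_ 0#) (≡.sym (List.map-∘ (support p))))

    scale : ∀ (α : Vec ℕ n) → Vec.sum α ≤ degree p →
      v zero ^ (degree p ∸ Vec.sum α) * monomial (v ∘ suc) α ≈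
      k ^ degree p * (w zero ^ (degree p ∸ Vec.sum α) * monomial (w ∘ suc) α)
    scale α le = trans (monomial-scale {v = v} {w} v≈kw ((degree p ∸ Vec.sum α) ∷ α))
      (*-congʳ (^-congʳ k (ℕ.m∸n+n≡m le)))

-- Cardinalities of setoids.

private
  variable
    a b p ℓ ℓ′ : Level
    M N : ℕ

_∣ₛ_ : (S : Setoid a ℓ) → (Setoid.Carrier S → Set p) → Setoid _ _
S ∣ₛ P = On.setoid {B = ∃ P} S proj₁

module _ {S : Setoid a ℓ} {T : Setoid b ℓ′} where

  open Setoid S using () renaming (_≈_ to _≈₁_)
  open Setoid T using () renaming (_≈_ to _≈₂_)

  bijective⇒Inverse : ∀ f → Congruent _≈₁_ _≈₂_ f → Injective _≈₁_ _≈₂_ f →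
                      StrictlySurjective _≈₂_ f → Inverse S T
  bijective⇒Inverse f cong inj surj = Bijection⇒Inverse (record
    { to        = f
    ; cong      = cong
    ; bijective = inj , strictlySurjective⇒surjective S T cong surj
    })

  HasCardinality-↔ : Inverse S T → HasCardinality S N → HasCardinality T N
  HasCardinality-↔ S↔T S-card =
    Composition.inverse (Symmetry.inverse S↔T) S-card

  HasCardinality-unique : Inverse S T → HasCardinality S M → HasCardinality T N →
                          M ≡ N
  HasCardinality-unique S↔T S-card T-card = Perm.↔⇒≡
    (Composition.inverse (Symmetry.inverse S-card) (Composition.inverse S↔T T-card))

  HasCardinality-× : HasCardinality S M → HasCardinality T N →
                     HasCardinality (S Product.×ₛ T) (M ℕ.* N)
  HasCardinality-× S-card T-card = Composition.inverse (S-card ×-inverse T-card)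
    (Composition.inverse Product.Pointwise-≡↔≡ (Symmetry.inverse Fin.*↔×))

  HasCardinality-⊎ : HasCardinality S M → HasCardinality T N →
                     HasCardinality (S Sum.⊎ₛ T) (M ℕ.+ N)
  HasCardinality-⊎ S-card T-card = Composition.inverse (S-card ⊎-inverse T-card)
    (Composition.inverse (Sum.Pointwise-≡↔≡ _ _) (Symmetry.inverse Fin.+↔⊎))

HasCardinality-enumeration : ∀ (S : Setoid a ℓ) → let open Setoid S in
  (f : Fin N → Carrier) → (∀ {i j} → f i ≈ f j → i ≡ j) → (∀ x → ∃[ i ] f i ≈ x) →
  HasCardinality S N
HasCardinality-enumeration S f inj surj =
  Symmetry.inverse (bijective⇒Inverse f (reflexive ∘ ≡.cong f) inj surj)
  where open Setoid S using (reflexive)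

Fin-∣ₛ-finite : ∀ {P : Fin N → Set p} → (∀ i → Dec (P i)) →
                ∃[ k ] HasCardinality (≡.setoid (Fin N) ∣ₛ P) k
Fin-∣ₛ-finite {zero} P? =
  0 , HasCardinality-enumeration _ (λ ()) (λ { {()} }) (λ { (() , _) })
Fin-∣ₛ-finite {suc N} {P = P} P? with Fin-∣ₛ-finite (P? ∘ suc) | P? zero
... | k , card | yes p₀ = suc k , HasCardinality-enumeration _ f f-injective f-surjective
  where
  open Inverse card
  f : Fin (suc k) → ∃ P
  f zero    = zero , p₀
  f (suc j) = suc (proj₁ (from j)) , proj₂ (from j)

  f-injective : ∀ {i j} → proj₁ (f i) ≡ proj₁ (f j) → i ≡ j
  f-injective {zero}  {zero}  _  = ≡.refl
  f-injective {suc i} {suc j} eq = ≡.cong suc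
    (≡.trans (≡.sym (strictlyInverseˡ _)) (inverseˡ (Fin.suc-injective eq)))

  f-surjective : ∀ x → ∃[ i ] proj₁ (f i) ≡ proj₁ x
  f-surjective (zero  , _) = zero , ≡.refl
  f-surjective (suc x , p) = suc (to (x , p)) , ≡.cong suc (strictlyInverseʳ _)
... | k , card | no ¬p₀ = k , HasCardinality-enumeration _ f f-injective f-surjective
  where
  open Inverse card
  f : Fin k → ∃ P
  f j = suc (proj₁ (from j)) , proj₂ (from j)

  f-injective : ∀ {i j} → proj₁ (f i) ≡ proj₁ (f j) → i ≡ j
  f-injective eq =
    ≡.trans (≡.sym (strictlyInverseˡ _)) (inverseˡ (Fin.suc-injective eq))

  f-surjective : ∀ x → ∃[ i ] proj₁ (f i) ≡ proj₁ x
  f-surjective (zero  , p) = contradiction p ¬p₀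
  f-surjective (suc x , p) = to (x , p) , ≡.cong suc (strictlyInverseʳ _)

-- Only the existence of a size is asserted; for 𝔽_q its value is found afterwards by comparing
-- squares.
∣ₛ-finite : ∀ {S : Setoid a ℓ} {P : Setoid.Carrier S → Set p} → HasCardinality S N →
            P Respects (Setoid._≈_ S) → (∀ x → Dec (P x)) →
            ∃[ k ] HasCardinality (S ∣ₛ P) k
∣ₛ-finite {S = S} {P} card resp P? with Fin-∣ₛ-finite (P? ∘ Inverse.from card)
... | k , card′ = k , HasCardinality-↔ (bijective⇒Inverse
  (λ (i , p) → from i , p) from-cong
  (λ eq → ≡.trans (≡.sym (strictlyInverseˡ _)) (inverseˡ eq))
  (λ (x , p) → (to x , resp (sym (strictlyInverseʳ _)) p) , strictlyInverseʳ _)) card′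
  where
  open Inverse card
  open Setoid S using (sym)

-- Fields and finite fields.

module FieldProperties {c ℓ} (F : Field c ℓ) where

  open Field F hiding (zero)
  open import Relation.Binary.Reasoning.Setoid setoid

  *-cancelˡ-nonZero : ∀ {x y z} → x ≉ 0# → x * y ≈ x * z → y ≈ z
  *-cancelˡ-nonZero {x} {y} {z} x≉0 xy≈xz with inv x x≉0
  ... | x⁻¹ , x⁻¹x≈1 , _ = begin
    y               ≈⟨ *-identityˡ y ⟨
    1# * y          ≈⟨ *-congʳ x⁻¹x≈1 ⟨
    x⁻¹ * x * y     ≈⟨ *-assoc x⁻¹ x y ⟩
    x⁻¹ * (x * y)   ≈⟨ *-congˡ xy≈xz ⟩
    x⁻¹ * (x * z)   ≈⟨ *-assoc x⁻¹ x z ⟨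
    x⁻¹ * x * z     ≈⟨ *-congʳ x⁻¹x≈1 ⟩
    1# * z          ≈⟨ *-identityˡ z ⟩
    z               ∎

  *-nonZero : ∀ {x y} → x ≉ 0# → y ≉ 0# → x * y ≉ 0#
  *-nonZero x≉0 y≉0 xy≈0 = y≉0 (*-cancelˡ-nonZero x≉0 (trans xy≈0 (sym (zeroʳ _))))

  ^-nonZero : ∀ {x} k → x ≉ 0# → x ^ k ≉ 0#
  ^-nonZero zero    x≉0 = 1≉0
  ^-nonZero (suc k) x≉0 = *-nonZero x≉0 (^-nonZero k x≉0)

  product-nonZero : ∀ {n} (f : Vector Carrier n) → (∀ i → f i ≉ 0#) → product f ≉ 0#
  product-nonZero {zero}  f f≉0 = 1≉0
  product-nonZero {suc n} f f≉0 = *-nonZero (f≉0 zero) (product-nonZero (f ∘ suc) (f≉0 ∘ suc))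

module FiniteFieldProperties {c ℓ} (F : Field c ℓ) {N : ℕ}
                             (finite : HasCardinality (Field.setoid F) N) where

  open Field F hiding (zero)
  open FieldProperties F
  open import Relation.Binary.Reasoning.Setoid setoid
  open Inverse finite using (to; from; to-cong; strictlyInverseˡ; strictlyInverseʳ)
  open Algebra.Properties.Semiring.Mult semiring
    using (×1-homo-*) renaming (_×_ to _·_)
  open Algebra.Properties.Group +-group using (identityˡ-unique)
  private
    module ∑ = Algebra.Properties.CommutativeMonoid.Sum +-commutativeMonoid
    module ∏ = Algebra.Properties.CommutativeMonoid.Sum *-commutativeMonoid

  infix 4 _≟_
  opaque
    _≟_ : Decidable _≈_
    _≟_ = Fin.inj⇒≟ (Inverse⇒Injection finite)

  *-zero⇒⊎ : ∀ {x y} → x * y ≈ 0# → x ≈ 0# ⊎ y ≈ 0#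
  *-zero⇒⊎ {x} {y} xy≈0 with x ≟ 0# | y ≟ 0#
  ... | yes x≈0 | _       = inj₁ x≈0
  ... | no _    | yes y≈0 = inj₂ y≈0
  ... | no x≉0  | no y≉0  = contradiction xy≈0 (*-nonZero x≉0 y≉0)

  -- Transport along the enumeration turns a bijection of the field into a permutation of indices,
  -- by which sums and products over `from` can be reindexed.
  conjugate : ∀ (g h : Carrier → Carrier) →
    (∀ {x y} → x ≈ y → g x ≈ g y) → (∀ {x y} → x ≈ y → h x ≈ h y) →
    (∀ x → g (h x) ≈ x) → (∀ x → h (g x) ≈ x) → Perm.Permutation N N
  conjugate g h g-cong h-cong gh hg = Perm.permutation (to ∘ g ∘ from) (to ∘ h ∘ from)
    (λ i → ≡.trans (to-cong (trans (g-cong (strictlyInverseʳ _)) (gh _))) (strictlyInverseˡ i))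
    (λ i → ≡.trans (to-cong (trans (h-cong (strictlyInverseʳ _)) (hg _))) (strictlyInverseˡ i))

  -- Translating all elements by 1 does not change their sum.
  N·1≈0 : N · 1# ≈ 0#
  N·1≈0 = identityˡ-unique _ (sum from) (begin
    N · 1# + sum from                            ≈⟨ +-congʳ (∑.sum-replicate N) ⟨
    sum {N} (λ _ → 1#) + sum from                ≈⟨ ∑.∑-distrib-+ (λ _ → 1#) from ⟨
    sum (λ i → 1# + from i)                      ≈⟨ ∑.sum-cong-≋ {N} (λ i → strictlyInverseʳ (1# + from i)) ⟨
    sum (λ i → from (π Perm.⟨$⟩ʳ i))             ≈⟨ ∑.sum-permute from π ⟨
    sum from                                     ∎)
    where
    cancel : ∀ {x y} → x + y ≈ 0# → ∀ z → x + (y + z) ≈ z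
    cancel e z = trans (sym (+-assoc _ _ _)) (trans (+-congʳ e) (+-identityˡ z))
    π = conjugate (1# +_) (- 1# +_) +-congˡ +-congˡ
          (cancel (-‿inverseʳ 1#)) (cancel (-‿inverseˡ 1#))

  product-single : ∀ {n} (f : Vector Carrier n) i → (∀ j → j ≢ i → f j ≈ 1#) →
                   product f ≈ f i
  product-single {suc n} f i f≈1 = begin
    product f                          ≈⟨ ∏.sum-remove f ⟩
    f i * product (f ∘ punchIn i)      ≈⟨ *-congˡ (∏.sum-cong-≋ (λ j → f≈1 _ (Fin.punchInᵢ≢i i j))) ⟩
    f i * product {n} (λ _ → 1#)       ≈⟨ *-congˡ (∏.sum-replicate-zero n) ⟩
    f i * 1#                           ≈⟨ *-identityʳ _ ⟩
    f i                                ∎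

  -- Multiplication by a permutes the nonzero elements; φ replaces the zero
  -- element by 1, and the factor ζ x corrects a * φ x ≈ φ (a * x) at x = 0.
  x^N≈x : ∀ a → a ^ N ≈ a
  x^N≈x a with a ≟ 0#
  ... | yes a≈0 = trans (0^N (to 0#)) (sym a≈0)
    where
    0^N : ∀ {n} → Fin n → a ^ n ≈ 0#
    0^N {suc n} _ = trans (*-congʳ a≈0) (zeroˡ _)
  ... | no a≉0 with inv a a≉0
  ... | a⁻¹ , a⁻¹a≈1 , aa⁻¹≈1 = *-cancelˡ-nonZero P≉0 (begin
    P * a ^ N                                      ≈⟨ *-comm P _ ⟩
    a ^ N * P                                      ≈⟨ *-congʳ (∏.sum-replicate N) ⟨
    product {N} (λ _ → a) * P                      ≈⟨ ∏.∑-distrib-+ (λ _ → a) (φ ∘ from) ⟨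
    product (λ i → a * φ (from i))                 ≈⟨ ∏.sum-cong-≋ (λ i → φ-* (from i)) ⟨
    product (λ i → φ (a * from i) * ζ (from i))    ≈⟨ ∏.∑-distrib-+ (λ i → φ (a * from i)) (ζ ∘ from) ⟩
    product (λ i → φ (a * from i)) * product (ζ ∘ from)
                                                   ≈⟨ *-cong permuted single ⟩
    P * a                                          ∎)
    where
    φ ζ : Carrier → Carrier
    φ x = if does (x ≟ 0#) then 1# else x
    ζ x = if does (x ≟ 0#) then a else 1#

    φ≉0 : ∀ x → φ x ≉ 0#
    φ≉0 x with x ≟ 0#
    ... | yes _  = 1≉0
    ... | no x≉0 = x≉0

    φ-cong : ∀ {x y} → x ≈ y → φ x ≈ φ y
    φ-cong {x} {y} x≈y with x ≟ 0# | y ≟ 0#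
    ... | yes _   | yes _   = refl
    ... | yes x≈0 | no y≉0  = contradiction (trans (sym x≈y) x≈0) y≉0
    ... | no x≉0  | yes y≈0 = contradiction (trans x≈y y≈0) x≉0
    ... | no _    | no _    = x≈y

    φ-* : ∀ x → φ (a * x) * ζ x ≈ a * φ x
    φ-* x with x ≟ 0# | a * x ≟ 0#
    ... | yes x≈0 | yes _    = *-comm 1# a
    ... | yes x≈0 | no ax≉0  = contradiction (trans (*-congˡ x≈0) (zeroʳ a)) ax≉0
    ... | no x≉0  | yes ax≈0 = contradiction ax≈0 (*-nonZero a≉0 x≉0)
    ... | no _    | no _     = *-identityʳ _

    P = product (φ ∘ from)

    P≉0 : P ≉ 0#
    P≉0 = product-nonZero (φ ∘ from) (φ≉0 ∘ from)

    cancel : ∀ {x y} → x * y ≈ 1# → ∀ z → x * (y * z) ≈ z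
    cancel e z = trans (sym (*-assoc _ _ _)) (trans (*-congʳ e) (*-identityˡ z))

    π = conjugate (a *_) (a⁻¹ *_) *-congˡ *-congˡ (cancel aa⁻¹≈1) (cancel a⁻¹a≈1)

    permuted : product (λ i → φ (a * from i)) ≈ P
    permuted = begin
      product (λ i → φ (a * from i))                ≈⟨ ∏.sum-cong-≋ {N} (λ i → φ-cong (strictlyInverseʳ (a * from i))) ⟨
      product (λ i → φ (from (π Perm.⟨$⟩ʳ i)))      ≈⟨ ∏.sum-permute (φ ∘ from) π ⟨
      P                                             ∎

    ζ-zero : ∀ x → x ≈ 0# → ζ x ≈ a
    ζ-zero x x≈0 with x ≟ 0#
    ... | yes _  = refl
    ... | no x≉0 = contradiction x≈0 x≉0

    ζ-nonZero : ∀ x → x ≉ 0# → ζ x ≈ 1#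
    ζ-nonZero x x≉0 with x ≟ 0#
    ... | yes x≈0 = contradiction x≈0 x≉0
    ... | no _    = refl

    single : product (ζ ∘ from) ≈ a
    single = trans
      (product-single (ζ ∘ from) (to 0#) (λ j j≢ → ζ-nonZero (from j) (λ from≈0 →
        j≢ (≡.trans (≡.sym (strictlyInverseˡ j)) (to-cong from≈0)))))
      (ζ-zero _ (strictlyInverseʳ 0#))

  -- The vanishing multiple 2 ^ k of `1#` is a product of `k` factors `1# + 1#`, and there are no
  -- zero divisors; `k` = 0 would give `1# ≈ 0#`.
  1+1≈0 : ∀ {k} → N ≡ 2 ℕ.^ k → 1# + 1# ≈ 0#
  1+1≈0 {k} ≡.refl = go k N·1≈0
    where
    go : ∀ k → (2 ℕ.^ k) · 1# ≈ 0# → 1# + 1# ≈ 0#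
    go zero    e = contradiction (trans (sym (+-identityʳ 1#)) e) 1≉0
    go (suc k) e = [ trans (+-congˡ (sym (+-identityʳ 1#))) , go k ]′
                   (*-zero⇒⊎ (trans (sym (×1-homo-* 2 (2 ℕ.^ k))) e))

-- Commutative rings of characteristic two.

module CharacteristicTwo {c ℓ} (R : CommutativeRing c ℓ)
  (1+1≈0 : CommutativeRing._≈_ R
             (CommutativeRing._+_ R (CommutativeRing.1# R) (CommutativeRing.1# R))
             (CommutativeRing.0# R)) where

  open CommutativeRing R

  open Algebra.Definitions.RawSemiring (Semiring.rawSemiring semiring)
    using (_^_)
  open Algebra.Properties.CommutativeSemiring.Exp commutativeSemiring
    using (^-congˡ; ^-congʳ; ^-assocʳ)
  open Algebra.Properties.Group +-group using (inverseʳ-unique)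
  open import Relation.Binary.Reasoning.Setoid setoid

  x+x≈0 : ∀ x → x + x ≈ 0#
  x+x≈0 x = begin
    x + x            ≈⟨ +-cong (*-identityʳ x) (*-identityʳ x) ⟨
    x * 1# + x * 1#  ≈⟨ distribˡ x 1# 1# ⟨
    x * (1# + 1#)    ≈⟨ *-congˡ 1+1≈0 ⟩
    x * 0#           ≈⟨ zeroʳ x ⟩
    0#               ∎

  -x≈x : ∀ x → - x ≈ x
  -x≈x x = sym (inverseʳ-unique x x (x+x≈0 x))

  x+y≈0⇒x≈y : ∀ {x y} → x + y ≈ 0# → x ≈ y
  x+y≈0⇒x≈y {x} {y} e = sym (trans (inverseʳ-unique x y e) (-x≈x x))

  private
    fromBool : Bool → Carrier
    fromBool b = if b then 1# else 0#

    fromBool-homo-+ : ∀ a b → fromBool (a xor b) ≈ fromBool a + fromBool b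
    fromBool-homo-+ false b     = sym (+-identityˡ _)
    fromBool-homo-+ true  false = sym (+-identityʳ _)
    fromBool-homo-+ true  true  = sym 1+1≈0

    fromBool-homo-* : ∀ a b → fromBool (a ∧ b) ≈ fromBool a * fromBool b
    fromBool-homo-* false b = sym (zeroˡ _)
    fromBool-homo-* true  b = sym (*-identityˡ _)

    fromBool-homo : CommutativeRing.rawRing Bool.xor-∧-commutativeRing
                    ACR.-Raw-AlmostCommutative⟶ ACR.fromCommutativeRing R
    fromBool-homo = record
      { ⟦_⟧    = fromBool
      ; +-homo = fromBool-homo-+
      ; *-homo = fromBool-homo-*
      ; -‿homo = λ a → sym (-x≈x (fromBool a))
      ; 0-homo = refl
      ; 1-homo = refl
      }

    fromBool-≟ : WeaklyDecidable (ACR.Induced-equivalence fromBool-homo)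
    fromBool-≟ false false = just refl
    fromBool-≟ true  true  = just refl
    fromBool-≟ _     _     = nothing

  -- With coefficients in 𝔽₂ the ring solver knows that x + x ≈ 0#.
  module Solver = Algebra.Solver.Ring _ _ fromBool-homo fromBool-≟

  ^-2^suc : ∀ x k → x ^ (2 ℕ.^ suc k) ≈ (x ^ (2 ℕ.^ k)) ^ 2
  ^-2^suc x k = trans (^-congʳ x (ℕ.*-comm 2 (2 ℕ.^ k))) (sym (^-assocʳ x (2 ℕ.^ k) 2))

  frobenius-+ : ∀ k x y → (x + y) ^ (2 ℕ.^ k) ≈ x ^ (2 ℕ.^ k) + y ^ (2 ℕ.^ k)
  frobenius-+ zero    x y =
    trans (*-identityʳ _) (+-cong (sym (*-identityʳ x)) (sym (*-identityʳ y)))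
  frobenius-+ (suc k) x y = begin
    (x + y) ^ (2 ℕ.^ suc k)                            ≈⟨ ^-2^suc (x + y) k ⟩
    ((x + y) ^ (2 ℕ.^ k)) ^ 2                          ≈⟨ ^-congˡ 2 (frobenius-+ k x y) ⟩
    (x ^ (2 ℕ.^ k) + y ^ (2 ℕ.^ k)) ^ 2                ≈⟨ square-+ _ _ ⟩
    (x ^ (2 ℕ.^ k)) ^ 2 + (y ^ (2 ℕ.^ k)) ^ 2          ≈⟨ +-cong (^-2^suc x k) (^-2^suc y k) ⟨
    x ^ (2 ℕ.^ suc k) + y ^ (2 ℕ.^ suc k)              ∎
    where
    open Solver using (solve; _:=_; _:+_; _:^_)

    square-+ : ∀ x y → (x + y) ^ 2 ≈ x ^ 2 + y ^ 2
    square-+ = solve 2 (λ x y → (x :+ y) :^ 2 := x :^ 2 :+ y :^ 2) refl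

private
  2^>0 : ∀ n → 0 < 2 ℕ.^ n
  2^>0 n = ℕ.m^n>0 2 n

  -- The left side is bracketed as `Parameters` is: affine points, then the cone over the `m` roots,
  -- then its vertex.
  count : ∀ q m → q ℕ.^ 2 ℕ.* (q ℕ.^ 2 ℕ.* q) ℕ.+ (q ℕ.^ 2 ℕ.* m ℕ.+ 1) ≡
                  q ℕ.^ 5 ℕ.+ m ℕ.* q ℕ.^ 2 ℕ.+ 1
  count = solve 2 (λ q m → q :^ 2 :* (q :^ 2 :* q) :+ (q :^ 2 :* m :+ con 1)
                           := q :^ 5 :+ m :* q :^ 2 :+ con 1) ≡.refl
    where open Data.Nat.Solver.+-*-Solver

  [2s²]²≡s⁴*4 : ∀ s → (2 ℕ.* (s ℕ.^ 2)) ℕ.^ 2 ≡ s ℕ.* s ℕ.* (s ℕ.* s) ℕ.* 4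
  [2s²]²≡s⁴*4 = solve 1 (λ s → (con 2 :* (s :^ 2)) :^ 2 := s :* s :* (s :* s) :* con 4) ≡.refl
    where open Data.Nat.Solver.+-*-Solver

record QuadraticExtension {c ℓ} (F : Field c ℓ) (e : ℕ) : Set (c L.⊔ ℓ) where
  open Field F
  field
    0<e     : 0 < e
    finite  : HasCardinality setoid ((2 ℕ.^ e) ℕ.^ 2)
    ε δ     : Carrier
    ε∉      : ¬ InSubfield (2 ℕ.^ e) ε
    δ∈      : InSubfield (2 ℕ.^ e) δ
    trace-δ : trace e δ ≈ 1#
    ε-root  : ε ^ 2 + ε + δ ≈ 0#

module Variety {c ℓ} (F : Field c ℓ) (e : ℕ) (E : QuadraticExtension F e) where

  open Field F hiding (zero)
  open QuadraticExtension E
  open Hypersurface F finite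
  open Projective F
  open Polynomial commutativeRing (Fin.inj⇒≟ (Inverse⇒Injection finite))
  open PolynomialProperties commutativeRing (Fin.inj⇒≟ (Inverse⇒Injection finite))
  open PowerProperties commutativeRing
  open FieldProperties F
  open FiniteFieldProperties F finite
  open CharacteristicTwo commutativeRing
    (1+1≈0 {e ℕ.* 2} (ℕ.^-*-assoc 2 e 2))
  open Algebra.Properties.CommutativeSemiring.Exp commutativeSemiring
    using (^-homo-*; ^-distrib-*; ^-assocʳ; ^-congˡ; ^-congʳ)
  open Algebra.Properties.Group +-group
    using () renaming (∙-cancelʳ to +-cancelʳ)
  open import Relation.Binary.Reasoning.Setoid setoid
  open Solver using (solve; con; _:=_; _:+_; _:*_; _:^_)

  -- The trace from 𝔽_q² to 𝔽_q and the basis 1, ε.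

  q : ℕ
  q = 2 ℕ.^ e

  ^-swap : ∀ x m n → (x ^ m) ^ n ≈ (x ^ n) ^ m
  ^-swap x m n = trans (^-assocʳ x m n)
    (trans (^-congʳ x (ℕ.*-comm m n)) (sym (^-assocʳ x n m)))

  x^q^q≈x : ∀ x → (x ^ q) ^ q ≈ x
  x^q^q≈x x = trans (^-assocʳ x q q)
    (trans (^-congʳ x (≡.cong (q ℕ.*_) (≡.sym (ℕ.*-identityʳ q)))) (x^N≈x x))

  Subfield-+ : ∀ {x y} → InSubfield q x → InSubfield q y → InSubfield q (x + y)
  Subfield-+ x∈ y∈ = trans (frobenius-+ e _ _) (+-cong x∈ y∈)

  Subfield-* : ∀ {x y} → InSubfield q x → InSubfield q y → InSubfield q (x * y)
  Subfield-* x∈ y∈ = trans (^-distrib-* _ _ q) (*-cong x∈ y∈)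

  Subfield-^ : ∀ {x} k → InSubfield q x → InSubfield q (x ^ k)
  Subfield-^ {x} k x∈ = trans (^-swap x k q) (^-congˡ k x∈)

  Tr : Carrier → Carrier
  Tr x = x ^ q + x

  Tr-cong : ∀ {x y} → x ≈ y → Tr x ≈ Tr y
  Tr-cong x≈y = +-cong (^-congˡ q x≈y) x≈y

  Tr-+ : ∀ x y → Tr (x + y) ≈ Tr x + Tr y
  Tr-+ x y = trans (+-congʳ (frobenius-+ e x y))
    (solve 4 (λ a b x y → (a :+ b) :+ (x :+ y) := (a :+ x) :+ (b :+ y)) refl _ _ x y)

  Tr∈Subfield : ∀ x → InSubfield q (Tr x)
  Tr∈Subfield x = trans (frobenius-+ e (x ^ q) x)
    (trans (+-congʳ (x^q^q≈x x)) (+-comm x (x ^ q)))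

  Subfield⇒Tr≈0 : ∀ {x} → InSubfield q x → Tr x ≈ 0#
  Subfield⇒Tr≈0 {x} x∈ = trans (+-congʳ x∈) (x+x≈0 x)

  Tr≈0⇒Subfield : ∀ {x} → Tr x ≈ 0# → InSubfield q x
  Tr≈0⇒Subfield = x+y≈0⇒x≈y

  -- Both ε and ε ^ q are roots of X² + X + δ, and they differ.
  Tr-ε : Tr ε ≈ 1#
  Tr-ε = [ (λ Trε≈0 → contradiction (Tr≈0⇒Subfield Trε≈0) ε∉) , x+y≈0⇒x≈y ]′
         (*-zero⇒⊎ (begin
    Tr ε * (Tr ε + 1#)
      ≈⟨ solve 3 (λ η ε δ → (η :+ ε) :* ((η :+ ε) :+ con true)
           := ((η :^ 2 :+ η) :+ δ) :+ ((ε :^ 2 :+ ε) :+ δ)) refl (ε ^ q) ε δ ⟩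
    ((ε ^ q) ^ 2 + ε ^ q + δ) + (ε ^ 2 + ε + δ)      ≈⟨ +-cong (+-congˡ δ∈) refl ⟨
    ((ε ^ q) ^ 2 + ε ^ q + δ ^ q) + (ε ^ 2 + ε + δ)  ≈⟨ +-congʳ (+-congʳ (+-congʳ (^-swap ε q 2))) ⟩
    ((ε ^ 2) ^ q + ε ^ q + δ ^ q) + (ε ^ 2 + ε + δ)  ≈⟨ +-congʳ (+-congʳ (frobenius-+ e (ε ^ 2) ε)) ⟨
    ((ε ^ 2 + ε) ^ q + δ ^ q) + (ε ^ 2 + ε + δ)      ≈⟨ +-congʳ (frobenius-+ e (ε ^ 2 + ε) δ) ⟨
    (ε ^ 2 + ε + δ) ^ q + (ε ^ 2 + ε + δ)            ≈⟨ +-cong (^-congˡ q ε-root) ε-root ⟩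
    0# ^ q + 0#                                      ≈⟨ +-identityʳ _ ⟩
    0# ^ q                                           ≈⟨ 0^q ⟩
    0#                                               ∎))
    where
    0^q : 0# ^ q ≈ 0#
    0^q = 0^ (2^>0 e) refl

  Tr-ε* : ∀ {y} → InSubfield q y → Tr (ε * y) ≈ y
  Tr-ε* {y} y∈ = begin
    (ε * y) ^ q + ε * y  ≈⟨ +-congʳ (^-distrib-* ε y q) ⟩
    ε ^ q * y ^ q + ε * y ≈⟨ +-congʳ (*-congˡ y∈) ⟩
    ε ^ q * y + ε * y    ≈⟨ distribʳ y (ε ^ q) ε ⟨
    Tr ε * y             ≈⟨ *-congʳ Tr-ε ⟩
    1# * y               ≈⟨ *-identityˡ y ⟩
    y                    ∎

  ε≉0 : ε ≉ 0#
  ε≉0 ε≈0 = 1≉0 (trans (sym Tr-ε) (trans (Tr-cong ε≈0) (Subfield⇒Tr≈0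
    (0^ (2^>0 e) refl))))

  +-cancel₂ : ∀ x y → x + y + y ≈ x
  +-cancel₂ = solve 2 (λ x y → (x :+ y) :+ y := x) refl

  -- `Tr x` lies in 𝔽_q and `ε` has trace `1#`, so the correction `ε * Tr x` has the same trace as
  -- `x` and the two cancel.
  Subfield-part : ∀ x → InSubfield q (x + ε * Tr x)
  Subfield-part x = Tr≈0⇒Subfield (trans (Tr-+ x (ε * Tr x))
    (trans (+-congˡ (Tr-ε* (Tr∈Subfield x))) (x+x≈0 (Tr x))))

  𝔽q : Setoid _ _
  𝔽q = setoid ∣ₛ InSubfield q

  -- `Tr` kills `a` and returns `b`, which gives injectivity; the preimage of `x` consists of
  -- `x + ε * Tr x` and `Tr x`.
  basis-↔ : Inverse (𝔽q Product.×ₛ 𝔽q) setoid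
  basis-↔ = bijective⇒Inverse (λ ((a , _) , (b , _)) → a + ε * b)
    (λ (a≈ , b≈) → +-cong a≈ (*-congˡ b≈))
    (λ {((a , a∈) , (b , b∈))} {((a′ , a′∈) , (b′ , b′∈))} eq →
      let b≈b′ = trans (sym (Tr-basis a∈ b∈)) (trans (Tr-cong eq) (Tr-basis a′∈ b′∈))
      in +-cancelʳ (ε * b) a a′ (trans eq (+-congˡ (*-congˡ (sym b≈b′)))) , b≈b′)
    (λ x → ((x + ε * Tr x , Subfield-part x) , (Tr x , Tr∈Subfield x)) ,
           +-cancel₂ x (ε * Tr x))
    where
    Tr-basis : ∀ {a b} → InSubfield q a → InSubfield q b → Tr (a + ε * b) ≈ b
    Tr-basis a∈ b∈ = trans (Tr-+ _ _)
      (trans (+-cong (Subfield⇒Tr≈0 a∈) (Tr-ε* b∈)) (+-identityˡ _))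

  -- By `basis-↔` the square of the unknown size is that of the whole field, q ^ 2. This replaces a
  -- count of the roots of X ^ q + X.
  𝔽q-card : HasCardinality 𝔽q q
  𝔽q-card with ∣ₛ-finite finite
                 (λ x≈y x∈ → trans (^-congˡ q (sym x≈y)) (trans x∈ x≈y))
                 (λ x → x ^ q ≟ x)
  ... | k , card = ≡.subst (HasCardinality 𝔽q) (square-injective
          (≡.trans (HasCardinality-unique basis-↔ (HasCardinality-× card card) finite)
                   (≡.cong (q ℕ.*_) (ℕ.*-identityʳ q)))) card
    where
    square-injective : ∀ {m n} → m ℕ.* m ≡ n ℕ.* n → m ≡ n
    square-injective eq = ℕ.≤-antisym
      (ℕ.≮⇒≥ λ n<m → ℕ.<-irrefl (≡.sym eq) (ℕ.*-mono-< n<m n<m))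
      (ℕ.≮⇒≥ λ m<n → ℕ.<-irrefl eq (ℕ.*-mono-< m<n m<n))

  -- Γ_ε takes values in 𝔽_q.

  σ D : ℕ
  σ = 2 ℕ.^ ((e ℕ.+ 1) / 2)
  D = (σ ℕ.+ 2) ℕ.* q

  ΓF : Carrier → Carrier
  ΓF = Γ (CommutativeRing.rawRing commutativeRing) e ε

  ΓF-cong : ∀ {x y} → x ≈ y → ΓF x ≈ ΓF y
  ΓF-cong {x} {y} x≈y = +-cong (+-cong (+-cong (+-cong
    (^-congˡ (σ ℕ.+ 2) (+-cong x≈y (*-congʳ Tr≈)))
    (^-congˡ σ Tr≈))
    (*-congʳ (+-cong (^-congˡ (2 ℕ.* q) x≈y) (^-congˡ 2 x≈y))))
    (^-congˡ (q ℕ.+ 1) x≈y))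
    (^-congˡ 2 x≈y)
    where
    Tr≈ : Tr x ≈ Tr y
    Tr≈ = Tr-cong x≈y

  -- With x₁ = Tr x and x₀ = x + ε * x₁, the last three terms of Γ_ε(x) are
  -- ε * x₁ ^ 2, x ^ (q + 1) and x ^ 2. As x ^ (q + 1) + x ^ 2 = x * x₁, their sum
  -- is x₀ * x₁.
  ΓF-subfield : ∀ x → ΓF x ≈ (x + ε * Tr x) ^ (σ ℕ.+ 2) + Tr x ^ σ + (x + ε * Tr x) * Tr x
  ΓF-subfield x = begin
    ΓF x
      ≈⟨ +-congʳ (+-cong (+-cong (+-congʳ (^-congˡ (σ ℕ.+ 2) (+-congˡ (*-comm _ ε))))
                                 (*-congʳ (+-congʳ x^2q)))
                         (trans (^-homo-* x q 1) (*-congˡ (*-identityʳ x)))) ⟩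
    X + Y + ((x ^ q) ^ 2 + x ^ 2) * ε + x ^ q * x + x ^ 2
      ≈⟨ solve 5 (λ X Y x y ε →
           (((X :+ Y) :+ ((y :^ 2 :+ x :^ 2) :* ε)) :+ (y :* x)) :+ (x :^ 2)
           := (X :+ Y) :+ ((x :+ (ε :* (y :+ x))) :* (y :+ x))) refl X Y x (x ^ q) ε ⟩
    X + Y + (x + ε * Tr x) * Tr x ∎
    where
    X = (x + ε * Tr x) ^ (σ ℕ.+ 2)
    Y = Tr x ^ σ
    x^2q : x ^ (2 ℕ.* q) ≈ (x ^ q) ^ 2
    x^2q = trans (sym (^-assocʳ x 2 q)) (^-swap x 2 q)

  ΓF∈Subfield : ∀ x → InSubfield q (ΓF x)
  ΓF∈Subfield x = trans (^-congˡ q (ΓF-subfield x)) (trans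
    (Subfield-+ (Subfield-+ (Subfield-^ (σ ℕ.+ 2) (Subfield-part x))
                            (Subfield-^ σ (Tr∈Subfield x)))
                (Subfield-* (Subfield-part x) (Tr∈Subfield x)))
    (sym (ΓF-subfield x)))

  -- Degree and top component of the affine equation.

  private
    1<q : 1 < q
    1<q = ℕ.<-≤-trans (s<s z<s) (ℕ.^-monoʳ-≤ 2 0<e)

    -- Together with `σq<D` this puts every summand of the equation other than the two powers with
    -- exponent σ + 2 strictly below degree `D`.
    2q<D : 2 ℕ.* q < D
    2q<D = ℕ.*-monoˡ-< q {{ℕ.>-nonZero (2^>0 e)}}
      (ℕ.+-monoˡ-< 2 (2^>0 ((e ℕ.+ 1) / 2)))

    σq<D : σ ℕ.* q < D
    σq<D = ℕ.*-monoˡ-< q {{ℕ.>-nonZero (2^>0 e)}} (ℕ.m<m+n σ z<s)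

    q+1≤2q : q ℕ.+ 1 ≤ 2 ℕ.* q
    q+1≤2q = ℕ.+-monoʳ-≤ q (ℕ.≤-trans (2^>0 e) (ℕ.≤-reflexive (≡.sym (ℕ.+-identityʳ q))))

    q*1≤q : q ℕ.* 1 ≤ q
    q*1≤q = ℕ.≤-reflexive (ℕ.*-identityʳ q)

    k*1<D : ∀ {k} → k ≤ 2 ℕ.* q → k ℕ.* 1 < D
    k*1<D {k} k≤2q = ℕ.≤-<-trans (ℕ.≤-trans (ℕ.≤-reflexive (ℕ.*-identityʳ k)) k≤2q) 2q<D

    2≤2q : 2 ≤ 2 ℕ.* q
    2≤2q = ℕ.*-monoʳ-≤ 2 {1} {q} (2^>0 e)

    q≤2q : q ≤ 2 ℕ.* q
    q≤2q = ℕ.m≤m+n q _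

  module _ {n} {t : Carrier} {v : Vector Carrier n} where

    -- `Γ` is one expression for all rings, so the derivation mirrors its syntax. At `t ≈ 1#` bounds
    -- can be raised freely, which brings all summands to the common degree `D`.
    HasForm-Γ₁ : t ≈ 1# → ∀ i →
      HasForm t v D (Γ (polyRing n) e (constant ε) (var i)) (ΓF (v i))
    HasForm-Γ₁ t≈1 i =
      HasForm-+ (HasForm-+ (HasForm-+ (HasForm-+
        (HasForm-^ (σ ℕ.+ 2) (HasForm-+ (up (ℕ.<⇒≤ 1<q) x)
          (up (ℕ.≤-reflexive (ℕ.+-identityʳ q)) (HasForm-* y (HasForm-constant ε)))))
        (up (ℕ.<⇒≤ σq<D) (HasForm-^ σ y)))
        (up (ℕ.≤-trans (ℕ.≤-reflexive (ℕ.+-identityʳ _)) (ℕ.<⇒≤ 2q<D)) (HasForm-*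
          (HasForm-+ (up (ℕ.≤-reflexive (ℕ.*-identityʳ _)) (HasForm-^ (2 ℕ.* q) x))
                     (up 2≤2q (HasForm-^ 2 x)))
          (HasForm-constant ε))))
        (up (ℕ.<⇒≤ (k*1<D q+1≤2q)) (HasForm-^ (q ℕ.+ 1) x)))
        (up (ℕ.<⇒≤ (k*1<D 2≤2q)) (HasForm-^ 2 x))
      where
      up : ∀ {d d′ p h} → d ≤ d′ → HasForm t v d p h → HasForm t v d′ p h
      up = HasForm-lift₁ t≈1

      x = HasForm-var {n} {t} {v} i
      y = HasForm-+ (up q*1≤q (HasForm-^ q x)) (up (ℕ.<⇒≤ 1<q) x)

    -- Only the power with exponent σ + 2 reaches degree `D`, and within its base only x ^ q * ε
    -- reaches degree `q`; everything else has slack and dies at `t ≈ 0#`.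
    HasForm-Γ₀ : t ≈ 0# → ∀ i →
      HasForm t v D (Γ (polyRing n) e (constant ε) (var i)) ((v i ^ q * ε) ^ (σ ℕ.+ 2))
    HasForm-Γ₀ t≈0 i = HasForm-≈
      (trans zeros (^-congˡ (σ ℕ.+ 2) (trans (+-identityˡ _) (*-congʳ (+-identityʳ _)))))
      (HasForm-+ (HasForm-+ (HasForm-+ (HasForm-+
        (HasForm-^ (σ ℕ.+ 2) (HasForm-+ (up 1<q x)
          (eq (ℕ.+-identityʳ q) (HasForm-* y (HasForm-constant ε)))))
        (up σq<D (HasForm-^ σ y)))
        (up (ℕ.≤-<-trans (ℕ.≤-reflexive (ℕ.+-identityʳ _)) 2q<D) (HasForm-*
          (HasForm-+ (eq (ℕ.*-identityʳ _) (HasForm-^ (2 ℕ.* q) x))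
                     -- The value of this summand can stay unsimplified, since the enclosing `up`
                     -- sends the whole product to `0#`.
                     (HasForm-lift 2≤2q (HasForm-^ 2 x)))
          (HasForm-constant ε))))
        (up (k*1<D q+1≤2q) (HasForm-^ (q ℕ.+ 1) x)))
        (up (k*1<D 2≤2q) (HasForm-^ 2 x)))
      where
      up : ∀ {d d′ p h} → d < d′ → HasForm t v d p h → HasForm t v d′ p 0#
      up = HasForm-lift₀ t≈0

      eq : ∀ {d d′ p h} → d ≡ d′ → HasForm t v d p h → HasForm t v d′ p h
      eq ≡.refl f = f

      x = HasForm-var {n} {t} {v} i
      y = HasForm-+ (eq (ℕ.*-identityʳ q) (HasForm-^ q x)) (up 1<q x)

      zeros : ∀ {z} → z + 0# + 0# + 0# + 0# ≈ z
      zeros = trans (+-identityʳ _) (trans (+-identityʳ _) (trans (+-identityʳ _) (+-identityʳ _)))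

  equation : Poly 3
  equation = affineEquation e ε 2

  HasForm-equation₁ : ∀ {t v} → t ≈ 1# →
    HasForm t v D equation (Tr (v 2F) + (ΓF (v 0F) + ΓF (v 1F)))
  HasForm-equation₁ {t} {v} t≈1 = HasForm-≈
    (+-congˡ (trans (-x≈x _) (+-congˡ (+-identityʳ _))))
    (HasForm-+
      (HasForm-+ (HasForm-lift₁ t≈1 (ℕ.<⇒≤ (k*1<D q≤2q)) (HasForm-^ q x₃))
                 (HasForm-lift₁ t≈1 (ℕ.<⇒≤ 1<D) x₃))
      (HasForm-neg (HasForm-+ (HasForm-Γ₁ t≈1 0F) (HasForm-+ (HasForm-Γ₁ t≈1 1F) HasForm-0))))
    where
    x₃ = HasForm-var {3} {t} {v} 2F
    1<D = k*1<D {1} (ℕ.≤-trans (2^>0 e) q≤2q)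

  HasForm-equation₀ : ∀ {t v} → t ≈ 0# →
    HasForm t v D equation ((v 0F ^ q * ε) ^ (σ ℕ.+ 2) + (v 1F ^ q * ε) ^ (σ ℕ.+ 2))
  HasForm-equation₀ {t} {v} t≈0 = HasForm-≈
    (trans (+-cong (+-identityʳ _) (trans (-x≈x _) (+-congˡ (+-identityʳ _)))) (+-identityˡ _))
    (HasForm-+
      (HasForm-+ (HasForm-lift₀ t≈0 (k*1<D q≤2q) (HasForm-^ q x₃))
                 (HasForm-lift₀ t≈0 1<D x₃))
      (HasForm-neg (HasForm-+ (HasForm-Γ₀ t≈0 0F) (HasForm-+ (HasForm-Γ₀ t≈0 1F) HasForm-0))))
    where
    x₃ = HasForm-var {3} {t} {v} 2F
    1<D = k*1<D {1} (ℕ.≤-trans (2^>0 e) q≤2q)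

  -- At (1, 0, 0) the second summand of the top component vanishes and the first is a power of a
  -- nonzero multiple of `ε`, so nothing can cancel.
  degree-equation : degree equation ≡ D
  degree-equation = degree≡ {v = v} refl (HasForm-equation₀ refl)
    λ h → ^-nonZero (σ ℕ.+ 2) (*-nonZero (^-nonZero q 1≉0) ε≉0)
      (trans (sym (trans (+-congˡ second≈0) (+-identityʳ _))) h)
    where
    v : Vector Carrier 3
    v zero    = 1#
    v (suc _) = 0#

    second≈0 : (0# ^ q * ε) ^ (σ ℕ.+ 2) ≈ 0#
    second≈0 = 0^ (ℕ.≤-trans z<s (ℕ.m≤n+m 2 σ))
                  (trans (*-congʳ (0^ (2^>0 e) refl)) (zeroˡ ε))

  -- Parametrization of the rational points.

  record OnVariety (w : Vector Carrier 4) : Set ℓ where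
    constructor onVariety
    field
      vanishes : eval (homogenize equation) w ≈ 0#

  open OnVariety

  private
    eval≈ : ∀ w {h} → HasForm (w zero) (w ∘ suc) D equation h →
            eval (homogenize equation) w ≈ h
    eval≈ w f = trans (eval-homogenize equation w)
      (trans (reflexive (≡.cong (λ d → form (w zero) (w ∘ suc) d equation) degree-equation))
             (value f))

  OnVariety-scale : ∀ {v w k} → k ≉ 0# → (∀ i → v i ≈ k * w i) → OnVariety v → OnVariety w
  OnVariety-scale k≉0 v≈kw v∈ = onVariety (*-cancelˡ-nonZero (^-nonZero (degree equation) k≉0)
    (trans (trans (sym (eval-homogenize-scale equation v≈kw)) (vanishes v∈)) (sym (zeroʳ _))))

  OnVariety-affine : ∀ w → w 0F ≈ 1# →
    OnVariety w ⇔ (Tr (w 3F) ≈ ΓF (w 1F) + ΓF (w 2F))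
  OnVariety-affine w w₀≈1 = mk⇔
    (λ w∈ → x+y≈0⇒x≈y (trans (sym (eval≈ w (HasForm-equation₁ w₀≈1))) (vanishes w∈)))
    (λ eq → onVariety (trans (eval≈ w (HasForm-equation₁ w₀≈1)) (trans (+-congʳ eq) (x+x≈0 _))))

  -- Both summands of the top component have the form `ε ^ d * (x ^ d) ^ q`. The factor `ε ^ d`
  -- cancels, and the power `q` is undone by applying it once more.
  OnVariety-infinity : ∀ w → w 0F ≈ 0# →
    OnVariety w ⇔ (w 1F ^ (σ ℕ.+ 2) ≈ w 2F ^ (σ ℕ.+ 2))
  OnVariety-infinity w w₀≈0 = mk⇔
    (λ w∈ → begin
      w 1F ^ d              ≈⟨ x^q^q≈x _ ⟨
      ((w 1F ^ d) ^ q) ^ q  ≈⟨ ^-congˡ q (*-cancelˡ-nonZero ε^d≉0 (begin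
        ε ^ d * (w 1F ^ d) ^ q  ≈⟨ expand (w 1F) ⟨
        (w 1F ^ q * ε) ^ d      ≈⟨ x+y≈0⇒x≈y (trans (sym (eval≈ w (HasForm-equation₀ w₀≈0))) (vanishes w∈)) ⟩
        (w 2F ^ q * ε) ^ d      ≈⟨ expand (w 2F) ⟩
        ε ^ d * (w 2F ^ d) ^ q  ∎)) ⟩
      ((w 2F ^ d) ^ q) ^ q  ≈⟨ x^q^q≈x _ ⟩
      w 2F ^ d              ∎)
    (λ eq → onVariety (trans (eval≈ w (HasForm-equation₀ w₀≈0))
      (trans (+-congʳ (trans (expand (w 1F)) (trans (*-congˡ (^-congˡ q eq))
                                                     (sym (expand (w 2F))))))
             (x+x≈0 _))))
    where
    d = σ ℕ.+ 2
    ε^d≉0 : ε ^ d ≉ 0#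
    ε^d≉0 = ^-nonZero d ε≉0
    expand : ∀ x → (x ^ q * ε) ^ d ≈ ε ^ d * (x ^ d) ^ q
    expand x = trans (^-distrib-* (x ^ q) ε d) (trans (*-comm _ _) (*-congˡ (^-swap x q d)))
  μ : Setoid _ _
  μ = setoid ∣ₛ λ y → y ^ (σ ℕ.+ 2) ≈ 1#

  -- The affine points, the points at infinity with X₂ ≉ 0#, and the point
  -- (0 : 0 : 0 : 1).
  Parameters : Setoid _ _
  Parameters = (setoid Product.×ₛ (setoid Product.×ₛ 𝔽q)) Sum.⊎ₛ
               ((setoid Product.×ₛ μ) Sum.⊎ₛ ≡.setoid (Fin 1))

  private
    module P = Setoid Parameters
    module V = Setoid (𝒱 e ε 2)

    coordinates : Carrier → Carrier → Carrier → Carrier → Vector Carrier 4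
    coordinates x₀ x₁ x₂ x₃ = x₀ Vector.∷ x₁ Vector.∷ x₂ Vector.∷ x₃ Vector.∷ Vector.[]

    ΓΓ : Carrier → Carrier → Carrier
    ΓΓ x₁ x₂ = ΓF x₁ + ΓF x₂

    ΓΓ∈Subfield : ∀ x₁ x₂ → InSubfield q (ΓΓ x₁ x₂)
    ΓΓ∈Subfield x₁ x₂ = Subfield-+ (ΓF∈Subfield x₁) (ΓF∈Subfield x₂)

    point : P.Carrier → V.Carrier
    point (inj₁ (x₁ , x₂ , z , z∈)) =
      (coordinates 1# x₁ x₂ x₃ , λ x≈0 → 1≉0 (x≈0 0F)) ,
      vanishes (Equivalence.from (OnVariety-affine (coordinates 1# x₁ x₂ x₃) refl) (begin
        Tr (z + ε * ΓΓ x₁ x₂)       ≈⟨ Tr-+ z _ ⟩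
        Tr z + Tr (ε * ΓΓ x₁ x₂)    ≈⟨ +-cong (Subfield⇒Tr≈0 z∈) (Tr-ε* (ΓΓ∈Subfield x₁ x₂)) ⟩
        0# + ΓΓ x₁ x₂               ≈⟨ +-identityˡ _ ⟩
        ΓΓ x₁ x₂                    ∎))
      where x₃ = z + ε * ΓΓ x₁ x₂
    point (inj₂ (inj₁ (x₃ , y , y∈))) =
      (coordinates 0# y 1# x₃ , λ x≈0 → 1≉0 (x≈0 2F)) ,
      vanishes (Equivalence.from (OnVariety-infinity (coordinates 0# y 1# x₃) refl)
        (trans y∈ (sym (1^ (σ ℕ.+ 2) refl))))
    point (inj₂ (inj₂ _)) =
      (coordinates 0# 0# 0# 1# , λ x≈0 → 1≉0 (x≈0 3F)) ,
      vanishes (Equivalence.from (OnVariety-infinity (coordinates 0# 0# 0# 1#) refl) refl)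

    coordinates-cong : ∀ {x₀ x₁ x₂ x₃ y₀ y₁ y₂ y₃} → x₀ ≈ y₀ → x₁ ≈ y₁ → x₂ ≈ y₂ → x₃ ≈ y₃ →
      Proportional (coordinates x₀ x₁ x₂ x₃) (coordinates y₀ y₁ y₂ y₃)
    coordinates-cong e₀ e₁ e₂ e₃ = 1# , 1≉0 , λ
      { 0F → trans e₀ (sym (*-identityˡ _))
      ; 1F → trans e₁ (sym (*-identityˡ _))
      ; 2F → trans e₂ (sym (*-identityˡ _))
      ; 3F → trans e₃ (sym (*-identityˡ _))
      }

    point-cong : ∀ {x y} → x P.≈ y → point x V.≈ point y
    point-cong (Sum.inj₁ (e₁ , e₂ , ez)) = coordinates-cong refl e₁ e₂
      (+-cong ez (*-congˡ (+-cong (ΓF-cong e₁) (ΓF-cong e₂))))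
    point-cong (Sum.inj₂ (Sum.inj₁ (e₃ , ey))) = coordinates-cong refl ey refl e₃
    point-cong (Sum.inj₂ (Sum.inj₂ _)) = coordinates-cong refl refl refl refl

    -- Two proportional vectors normalized at the same coordinate have factor 1, so their other
    -- coordinates agree.
    cancel-1 : ∀ {k x y} → 1# ≈ k * 1# → x ≈ k * y → x ≈ y
    cancel-1 1≈k1 x≈ky =
      trans x≈ky (trans (*-congʳ (trans (sym (*-identityʳ _)) (sym 1≈k1))) (*-identityˡ _))

    1≉k*0 : ∀ {k} → 1# ≉ k * 0#
    1≉k*0 e = 1≉0 (trans e (zeroʳ _))

    0≉k*1 : ∀ {k} → k ≉ 0# → 0# ≉ k * 1#
    0≉k*1 k≉0 e = k≉0 (trans (sym (*-identityʳ _)) (sym e))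

    point-injective : ∀ {x y} → point x V.≈ point y → x P.≈ y
    point-injective {inj₁ (x₁ , x₂ , z , _)} {inj₁ (x₁′ , x₂′ , z′ , _)} (k , _ , eq) =
      Sum.inj₁ (e₁ , e₂ , +-cancelʳ (ε * ΓΓ x₁ x₂) z z′ (trans (cancel-1 (eq 0F) (eq 3F))
        (+-congˡ (*-congˡ (sym (+-cong (ΓF-cong e₁) (ΓF-cong e₂)))))))
      where
      e₁ = cancel-1 (eq 0F) (eq 1F)
      e₂ = cancel-1 (eq 0F) (eq 2F)
    point-injective {inj₁ _} {inj₂ (inj₁ _)} (_ , _ , eq) = contradiction (eq 0F) 1≉k*0
    point-injective {inj₁ _} {inj₂ (inj₂ _)} (_ , _ , eq) = contradiction (eq 0F) 1≉k*0
    point-injective {inj₂ (inj₁ _)} {inj₁ _} (_ , k≉0 , eq) = contradiction (eq 0F) (0≉k*1 k≉0)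
    point-injective {inj₂ (inj₂ _)} {inj₁ _} (_ , k≉0 , eq) = contradiction (eq 0F) (0≉k*1 k≉0)
    point-injective {inj₂ (inj₁ _)} {inj₂ (inj₁ _)} (_ , _ , eq) =
      Sum.inj₂ (Sum.inj₁ (cancel-1 (eq 2F) (eq 3F) , cancel-1 (eq 2F) (eq 1F)))
    point-injective {inj₂ (inj₁ _)} {inj₂ (inj₂ _)} (_ , _ , eq) = contradiction (eq 2F) 1≉k*0
    point-injective {inj₂ (inj₂ _)} {inj₂ (inj₁ _)} (_ , k≉0 , eq) = contradiction (eq 2F) (0≉k*1 k≉0)
    point-injective {inj₂ (inj₂ 0F)} {inj₂ (inj₂ 0F)} _ = Sum.inj₂ (Sum.inj₂ ≡.refl)

    normalize : ∀ (w : Vector Carrier 4) i → w i ≉ 0# →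
      ∃[ k ] k ≉ 0# × k * w i ≈ 1# × (OnVariety w → OnVariety (λ j → k * w j))
    normalize w i wᵢ≉0 with inv (w i) wᵢ≉0
    ... | k , kwᵢ≈1 , wᵢk≈1 =
      k , (λ k≈0 → 1≉0 (trans (sym kwᵢ≈1) (trans (*-congʳ k≈0) (zeroˡ _)))) , kwᵢ≈1 ,
      OnVariety-scale {v = w} wᵢ≉0 (λ j → sym (trans (sym (*-assoc _ _ _))
        (trans (*-congʳ wᵢk≈1) (*-identityˡ _))))

    point-covers : ∀ w → Nonzero w → OnVariety w →
      ∃[ x ] Proportional (proj₁ (proj₁ (point x))) w
    point-covers w w≉0 w∈ with w 0F ≟ 0#
    ... | no w₀≉0 =
      let k , k≉0 , kw₀≈1 , scale = normalize w 0F w₀≉0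
          u₁ = k * w 1F
          u₂ = k * w 2F
          u₃ = k * w 3F
          Tr-u₃ = Equivalence.to (OnVariety-affine (λ j → k * w j) kw₀≈1) (scale w∈)
          -- In characteristic two the shift in `point` is its own inverse; both summands have trace
          -- `ΓΓ u₁ u₂`, hence `z` lies in 𝔽_q.
          z = u₃ + ε * ΓΓ u₁ u₂
          z∈ = Tr≈0⇒Subfield (trans (Tr-+ u₃ (ε * ΓΓ u₁ u₂))
                 (trans (+-cong Tr-u₃ (Tr-ε* (ΓΓ∈Subfield u₁ u₂))) (x+x≈0 _)))
      in inj₁ (u₁ , u₂ , z , z∈) , k , k≉0 ,
         λ { 0F → sym kw₀≈1 ; 1F → refl ; 2F → refl ; 3F → +-cancel₂ u₃ (ε * ΓΓ u₁ u₂) }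
    ... | yes w₀≈0 with w 2F ≟ 0#
    ... | no w₂≉0 =
      let k , k≉0 , kw₂≈1 , scale = normalize w 2F w₂≉0
          kw₀≈0 = trans (*-congˡ w₀≈0) (zeroʳ k)
          y^≈1 = trans (Equivalence.to (OnVariety-infinity (λ j → k * w j) kw₀≈0) (scale w∈))
                       (1^ (σ ℕ.+ 2) kw₂≈1)
      in inj₂ (inj₁ (k * w 3F , k * w 1F , y^≈1)) , k , k≉0 ,
         λ { 0F → sym kw₀≈0 ; 1F → refl ; 2F → sym kw₂≈1 ; 3F → refl }
    ... | yes w₂≈0 =
      let k , k≉0 , kw₃≈1 , _ = normalize w 3F w₃≉0
      in inj₂ (inj₂ 0F) , k , k≉0 ,
         λ { 0F → sym (trans (*-congˡ w₀≈0) (zeroʳ k)) ; 1F → sym (trans (*-congˡ w₁≈0) (zeroʳ k))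
           ; 2F → sym (trans (*-congˡ w₂≈0) (zeroʳ k)) ; 3F → sym kw₃≈1 }
      where
      -- With X₀ and X₂ zero, the equation at infinity forces X₁ to vanish, so only the vertex of
      -- the cone remains.
      w₁^≈0 : w 1F ^ (σ ℕ.+ 2) ≈ 0#
      w₁^≈0 = trans (Equivalence.to (OnVariety-infinity w w₀≈0) w∈)
                    (0^ (ℕ.≤-trans z<s (ℕ.m≤n+m 2 σ)) w₂≈0)
      w₁≈0 : w 1F ≈ 0#
      w₁≈0 with w 1F ≟ 0#
      ... | yes w₁≈0 = w₁≈0
      ... | no w₁≉0  = contradiction w₁^≈0 (^-nonZero (σ ℕ.+ 2) w₁≉0)
      w₃≉0 : w 3F ≉ 0#
      w₃≉0 w₃≈0 = w≉0 λ { 0F → w₀≈0 ; 1F → w₁≈0 ; 2F → w₂≈0 ; 3F → w₃≈0 }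

  Parameters-↔ : Inverse Parameters (𝒱 e ε 2)
  Parameters-↔ = bijective⇒Inverse point (λ {x} {y} → point-cong {x} {y})
    (λ {x} {y} → point-injective {x} {y})
    (λ ((w , w≉0) , w∈) → point-covers w w≉0 (onVariety w∈))

  𝒱-card : ∀ {m} → HasCardinality μ m →
           HasCardinality (𝒱 e ε 2) (q ℕ.^ 5 ℕ.+ m ℕ.* q ℕ.^ 2 ℕ.+ 1)
  𝒱-card {m} μ-card = ≡.subst (HasCardinality (𝒱 e ε 2)) (count q m)
    (HasCardinality-↔ Parameters-↔
      (HasCardinality-⊎ (HasCardinality-× finite (HasCardinality-× finite 𝔽q-card))
        (HasCardinality-⊎ (HasCardinality-× finite μ-card)
          (HasCardinality-enumeration (≡.setoid (Fin 1)) id id (λ i → i , ≡.refl)))))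

  -- Solutions of y ^ (σ + 2) = 1.

  square≈1 : ∀ {x} → x ^ 2 ≈ 1# → x ≈ 1#
  square≈1 {x} x²≈1 = x+y≈0⇒x≈y ([ id , id ]′ (*-zero⇒⊎ (begin
    (x + 1#) * (x + 1#)
      ≈⟨ solve 1 (λ x → (x :+ con true) :* (x :+ con true) := x :^ 2 :+ con true) refl x ⟩
    x ^ 2 + 1#           ≈⟨ +-congʳ x²≈1 ⟩
    1# + 1#              ≈⟨ x+x≈0 1# ⟩
    0#                   ∎)))

  ^4⇒^4ʲ : ∀ {y} → y ^ 4 ≈ y → ∀ j → y ^ (2 ℕ.^ (j ℕ.* 2)) ≈ y
  ^4⇒^4ʲ {y} y⁴≈y zero    = *-identityʳ y
  ^4⇒^4ʲ {y} y⁴≈y (suc j) = begin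
    y ^ (2 ℕ.^ suc (suc (j ℕ.* 2)))  ≈⟨ ^-2^suc y (suc (j ℕ.* 2)) ⟩
    (y ^ (2 ℕ.^ suc (j ℕ.* 2))) ^ 2  ≈⟨ ^-congˡ 2 (^-2^suc y (j ℕ.* 2)) ⟩
    ((y ^ (2 ℕ.^ (j ℕ.* 2))) ^ 2) ^ 2 ≈⟨ ^-congˡ 2 (^-congˡ 2 (^4⇒^4ʲ y⁴≈y j)) ⟩
    (y ^ 2) ^ 2                      ≈⟨ ^-assocʳ y 2 2 ⟩
    y ^ 4                            ≈⟨ y⁴≈y ⟩
    y                                ∎

  trace-suc : ∀ n x → trace (suc n) x ≈ trace n x + x ^ (2 ℕ.^ n)
  trace-suc n x = trans (sum-init-last {n} (λ i → x ^ (2 ℕ.^ toℕ i)))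
    (+-cong (sum-cong-≋ {n} (λ i → ^-congʳ x (≡.cong (2 ℕ.^_) (Fin.toℕ-inject₁ i))))
            (^-congʳ x (≡.cong (2 ℕ.^_) (Fin.toℕ-fromℕ n))))
    where open Algebra.Properties.CommutativeMonoid.Sum +-commutativeMonoid
            using (sum-init-last; sum-cong-≋)

  halfTrace : ℕ → Carrier → Carrier
  halfTrace zero    x = x
  halfTrace (suc j) x = halfTrace j x + x ^ (2 ℕ.^ (suc j ℕ.* 2))

  -- `halfTrace j x` is the sum of x ^ (4 ^ i) for i up to `j`; squaring it supplies the exponents 2
  -- ^ i with i odd.
  halfTrace-quadratic : ∀ j x → halfTrace j x ^ 2 + halfTrace j x ≈ trace (suc j ℕ.* 2) x
  halfTrace-quadratic zero x =
    solve 1 (λ x → x :^ 2 :+ x := x :* con true :+ (x :* (x :* con true) :+ con false)) refl x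
  halfTrace-quadratic (suc j) x = begin
    (H + d) ^ 2 + (H + d)
      ≈⟨ solve 2 (λ H d → (H :+ d) :^ 2 :+ (H :+ d) := ((H :^ 2 :+ H) :+ d) :+ d :^ 2) refl H d ⟩
    H ^ 2 + H + d + d ^ 2
      ≈⟨ +-cong (+-congʳ (halfTrace-quadratic j x)) (sym (^-2^suc x n)) ⟩
    trace n x + d + x ^ (2 ℕ.^ suc n)
      ≈⟨ +-congʳ (trace-suc n x) ⟨
    trace (suc n) x + x ^ (2 ℕ.^ suc n)
      ≈⟨ trace-suc (suc n) x ⟨
    trace (suc (suc n)) x ∎
    where
    n = suc j ℕ.* 2
    H = halfTrace j x
    d = x ^ (2 ℕ.^ n)

  module _ {k : ℕ} (e≡ : e ≡ suc (k ℕ.* 2)) where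

    private
      σ≡ : σ ≡ 2 ℕ.* 2 ℕ.^ k
      σ≡ = ≡.cong (2 ℕ.^_) (≡.trans
        (≡.cong (_/ 2) (≡.trans (≡.cong (ℕ._+ 1) e≡) (ℕ.+-comm (suc (k ℕ.* 2)) 1)))
        (ℕ.m*n/n≡m (suc k) 2))

      s : ℕ
      s = 2 ℕ.^ k

    -- σ + 2 = 2 * (s + 1). As squaring is injective at `1#`, the equation y ^ (σ + 2) = 1 becomes y
    -- ^ s * y = 1.
    ^-σ+2 : ∀ y → y ^ (σ ℕ.+ 2) ≈ (y ^ s * y) ^ 2
    ^-σ+2 y = begin
      y ^ (σ ℕ.+ 2)        ≈⟨ ^-homo-* y σ 2 ⟩
      y ^ σ * y ^ 2        ≈⟨ *-congʳ (trans (^-congʳ y σ≡) (^-2^suc y k)) ⟩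
      (y ^ s) ^ 2 * y ^ 2  ≈⟨ ^-distrib-* (y ^ s) y 2 ⟨
      (y ^ s * y) ^ 2      ∎

    -- y ^ s is the inverse of y, so y ^ (s * s) ≈ y; and q ^ 2 ≡ 4 * s ^ 4.
    μ⇒^4 : ∀ {y} → y ^ s * y ≈ 1# → y ^ 4 ≈ y
    μ⇒^4 {y} yˢy≈1 = begin
      y ^ 4                                ≈⟨ ^-congˡ 4 (trans (^-congˡ (s ℕ.* s) y^ss) y^ss) ⟨
      ((y ^ (s ℕ.* s)) ^ (s ℕ.* s)) ^ 4    ≈⟨ ^-congˡ 4 (^-assocʳ y (s ℕ.* s) (s ℕ.* s)) ⟩
      (y ^ (s ℕ.* s ℕ.* (s ℕ.* s))) ^ 4    ≈⟨ ^-assocʳ y (s ℕ.* s ℕ.* (s ℕ.* s)) 4 ⟩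
      y ^ (s ℕ.* s ℕ.* (s ℕ.* s) ℕ.* 4)    ≈⟨ ^-congʳ y exponent ⟨
      y ^ (q ℕ.^ 2)                        ≈⟨ x^N≈x y ⟩
      y                                    ∎
      where
      exponent : q ℕ.^ 2 ≡ s ℕ.* s ℕ.* (s ℕ.* s) ℕ.* 4
      exponent = ≡.trans (≡.cong (ℕ._^ 2) (≡.trans (≡.cong (2 ℕ.^_) e≡)
        (≡.cong (2 ℕ.*_) (≡.sym (ℕ.^-*-assoc 2 k 2))))) ([2s²]²≡s⁴*4 s)

      yˢ≉0 : y ^ s ≉ 0#
      yˢ≉0 yˢ≈0 = 1≉0 (trans (sym yˢy≈1) (trans (*-congʳ yˢ≈0) (zeroˡ y)))

      y^ss : y ^ (s ℕ.* s) ≈ y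
      y^ss = *-cancelˡ-nonZero yˢ≉0 (begin
        y ^ s * y ^ (s ℕ.* s)    ≈⟨ *-comm _ _ ⟩
        y ^ (s ℕ.* s) * y ^ s    ≈⟨ *-congʳ (^-assocʳ y s s) ⟨
        (y ^ s) ^ s * y ^ s      ≈⟨ ^-distrib-* (y ^ s) y s ⟨
        (y ^ s * y) ^ s          ≈⟨ 1^ s yˢy≈1 ⟩
        1#                       ≈⟨ yˢy≈1 ⟨
        y ^ s * y                ∎)

    -- Here s = 4 ^ j, so y ^ 4 = y yields y ^ s = y, and the condition y ^ s * y = 1 reads y ^ 2 =
    -- 1.
    μ-card-even : ∀ j → k ≡ j ℕ.* 2 → HasCardinality μ 1
    μ-card-even j k≡ = HasCardinality-enumeration {N = 1} μ (λ _ → 1# , 1^ (σ ℕ.+ 2) refl)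
      (λ { {0F} {0F} _ → ≡.refl }) (λ (y , y∈) → 0F , sym (only-1 y∈))
      where
      only-1 : ∀ {y} → y ^ (σ ℕ.+ 2) ≈ 1# → y ≈ 1#
      only-1 {y} y∈ = square≈1 (begin
        y ^ 2      ≈⟨ *-congˡ (*-identityʳ y) ⟩
        y * y      ≈⟨ *-congʳ (trans (^-congʳ y (≡.cong (2 ℕ.^_) k≡)) (^4⇒^4ʲ (μ⇒^4 yˢy≈1) j)) ⟨
        y ^ s * y  ≈⟨ yˢy≈1 ⟩
        1#         ∎)
        where
        yˢy≈1 : y ^ s * y ≈ 1#
        yˢy≈1 = square≈1 (trans (sym (^-σ+2 y)) y∈)

    private
      ω : Carrier
      ω = ε + halfTrace k δ

      ω-root : ω ^ 2 + ω ≈ 1#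
      ω-root = begin
        ω ^ 2 + ω
          ≈⟨ solve 3 (λ ε H δ → (ε :+ H) :^ 2 :+ (ε :+ H)
               := ((ε :^ 2 :+ ε) :+ δ) :+ ((H :^ 2 :+ H) :+ δ))
               refl ε (halfTrace k δ) δ ⟩
        (ε ^ 2 + ε + δ) + (halfTrace k δ ^ 2 + halfTrace k δ + δ)
          ≈⟨ +-cong ε-root (+-congʳ (trans (halfTrace-quadratic k δ) trace-e+1)) ⟩
        0# + (1# + δ + δ)  ≈⟨ +-identityˡ _ ⟩
        1# + δ + δ         ≈⟨ +-cancel₂ 1# δ ⟩
        1#                 ∎
        where
        -- The sum has e + 1 terms, one more than the absolute trace; the extra term is δ ^ q = δ,
        -- exactly what `ε-root` cancels.
        trace-e+1 : trace (suc k ℕ.* 2) δ ≈ 1# + δ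
        trace-e+1 = trans (reflexive (≡.cong (λ n → trace (suc n) δ) (≡.sym e≡)))
          (trans (trace-suc e δ) (+-cong trace-δ δ∈))

      ω≉0 : ω ≉ 0#
      ω≉0 ω≈0 = 1≉0 (trans (sym ω-root)
        (trans (+-cong (0^ {2} z<s ω≈0) ω≈0) (+-identityˡ 0#)))

      ω≉1 : ω ≉ 1#
      ω≉1 ω≈1 = 1≉0 (trans (sym ω-root) (trans (+-cong (1^ 2 ω≈1) ω≈1) (x+x≈0 1#)))

      cubeRoot : Fin 3 → Carrier
      cubeRoot 0F = 1#
      cubeRoot 1F = ω
      cubeRoot 2F = ω + 1#

      ω+1≉1 : ω + 1# ≉ 1#
      ω+1≉1 eq = ω≉0 (+-cancelʳ 1# ω 0# (trans eq (sym (+-identityˡ 1#))))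

      ω≉ω+1 : ω ≉ ω + 1#
      ω≉ω+1 eq = 1≉0 (begin
        1#            ≈⟨ solve 1 (λ ω → con true := ω :+ (ω :+ con true)) refl ω ⟩
        ω + (ω + 1#)  ≈⟨ +-congˡ eq ⟨
        ω + ω         ≈⟨ x+x≈0 ω ⟩
        0#            ∎)

      cubeRoot-injective : ∀ {i j} → cubeRoot i ≈ cubeRoot j → i ≡ j
      cubeRoot-injective {0F} {0F} _  = ≡.refl
      cubeRoot-injective {0F} {1F} eq = contradiction (sym eq) ω≉1
      cubeRoot-injective {0F} {2F} eq = contradiction (sym eq) ω+1≉1
      cubeRoot-injective {1F} {0F} eq = contradiction eq ω≉1
      cubeRoot-injective {1F} {1F} _  = ≡.refl
      cubeRoot-injective {1F} {2F} eq = contradiction eq ω≉ω+1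
      cubeRoot-injective {2F} {0F} eq = contradiction eq ω+1≉1
      cubeRoot-injective {2F} {1F} eq = contradiction (sym eq) ω≉ω+1
      cubeRoot-injective {2F} {2F} _  = ≡.refl

      -- `ω` and `ω + 1#` have sum 1 and, by `ω-root`, product 1: they are the roots of y ^ 2 + y +
      -- 1.
      factorization : ∀ y → (y + 1#) * ((y + ω) * (y + (ω + 1#))) ≈ y ^ 3 + 1#
      factorization y = begin
        (y + 1#) * ((y + ω) * (y + (ω + 1#)))
          ≈⟨ solve 2 (λ y ω → (y :+ con true) :* ((y :+ ω) :* (y :+ (ω :+ con true)))
               := (y :+ con true) :* ((y :^ 2 :+ y) :+ (ω :^ 2 :+ ω))) refl y ω ⟩
        (y + 1#) * (y ^ 2 + y + (ω ^ 2 + ω))   ≈⟨ *-congˡ (+-congˡ ω-root) ⟩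
        (y + 1#) * (y ^ 2 + y + 1#)
          ≈⟨ solve 1 (λ y → (y :+ con true) :* ((y :^ 2 :+ y) :+ con true)
               := y :^ 3 :+ con true) refl y ⟩
        y ^ 3 + 1#                             ∎

      cubeRoot-^3 : ∀ i → cubeRoot i ^ 3 ≈ 1#
      cubeRoot-^3 i = x+y≈0⇒x≈y (trans (sym (factorization (cubeRoot i))) (root i))
        where
        root : ∀ i → (cubeRoot i + 1#) * ((cubeRoot i + ω) * (cubeRoot i + (ω + 1#))) ≈ 0#
        root 0F = trans (*-congʳ (x+x≈0 1#)) (zeroˡ _)
        root 1F = trans (*-congˡ (trans (*-congʳ (x+x≈0 ω)) (zeroˡ _))) (zeroʳ _)
        root 2F = trans (*-congˡ (trans (*-congˡ (x+x≈0 (ω + 1#))) (zeroʳ _))) (zeroʳ _)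

      cubeRoot-surjective : ∀ {y} → y ^ 3 ≈ 1# → ∃[ i ] cubeRoot i ≈ y
      cubeRoot-surjective {y} y³≈1 =
        [ (λ e → 0F , sym (x+y≈0⇒x≈y e))
        , [ (λ e → 1F , sym (x+y≈0⇒x≈y e))
          , (λ e → 2F , sym (x+y≈0⇒x≈y e))
          ]′ ∘ *-zero⇒⊎
        ]′ (*-zero⇒⊎ (trans (factorization y) (trans (+-congʳ y³≈1) (x+x≈0 1#))))

    -- Here s = 2 * 4 ^ j, so y ^ s * y = y ^ 3 whenever y ^ 4 = y. That holds for cube roots of
    -- unity at once and for elements of `μ` by `μ⇒^4`.
    μ-card-odd : ∀ j → k ≡ suc (j ℕ.* 2) → HasCardinality μ 3
    μ-card-odd j k≡ = HasCardinality-enumeration μ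
      (λ i → cubeRoot i , ^3⇒μ (cubeRoot-^3 i)) cubeRoot-injective
      (λ (y , y∈) → cubeRoot-surjective (μ⇒^3 y∈))
      where
      ^s : ∀ {y} → y ^ 4 ≈ y → y ^ s * y ≈ y ^ 3
      ^s {y} y⁴≈y = begin
        y ^ s * y                            ≈⟨ *-congʳ (^-congʳ y (≡.cong (2 ℕ.^_) k≡)) ⟩
        y ^ (2 ℕ.^ suc (j ℕ.* 2)) * y        ≈⟨ *-congʳ (^-2^suc y (j ℕ.* 2)) ⟩
        (y ^ (2 ℕ.^ (j ℕ.* 2))) ^ 2 * y      ≈⟨ *-congʳ (^-congˡ 2 (^4⇒^4ʲ y⁴≈y j)) ⟩
        y ^ 2 * y                            ≈⟨ *-comm _ _ ⟩
        y ^ 3                                ∎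

      ^3⇒μ : ∀ {y} → y ^ 3 ≈ 1# → y ^ (σ ℕ.+ 2) ≈ 1#
      ^3⇒μ {y} y³≈1 = trans (^-σ+2 y)
        (1^ 2 (trans (^s (trans (*-congˡ y³≈1) (*-identityʳ y))) y³≈1))

      μ⇒^3 : ∀ {y} → y ^ (σ ℕ.+ 2) ≈ 1# → y ^ 3 ≈ 1#
      μ⇒^3 {y} y∈ = trans (sym (^s (μ⇒^4 yˢy≈1))) yˢy≈1
        where
        yˢy≈1 : y ^ s * y ≈ 1#
        yˢy≈1 = square≈1 (trans (sym (^-σ+2 y)) y∈)

theorem3p2 :
    ∀ {c ℓ} (e : ℕ) → 3 ≤ e → e % 2 ≡ 1 →
    let q = 2 ℕ.^ e in
    (F : Field c ℓ) → let open Field F in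
    (finite : HasCardinality setoid (q ℕ.^ 2)) →
    (ε δ : Carrier) →
    ¬ InSubfield q ε →
    InSubfield q δ → δ ≉ 1# → trace e δ ≈ 1# →
    ε ^ 2 + ε + δ ≈ 0# →
    let open Hypersurface F finite in
    (e % 4 ≡ 1 → HasCardinality (𝒱 e ε 2) (q ℕ.^ 5 ℕ.+ q ℕ.^ 2 ℕ.+ 1)) ×
    (e % 4 ≡ 3 → HasCardinality (𝒱 e ε 2) (q ℕ.^ 5 ℕ.+ 3 ℕ.* q ℕ.^ 2 ℕ.+ 1))
theorem3p2 e 3≤e _ F finite ε δ ε∉ δ∈ _ trace-δ ε-root =
  -- Writing e = 2k + 1, the remainder 1 gives k = 2j and the remainder 3 gives k = 2j + 1, with j =
  -- e / 4.
  (λ e%4≡1 → ≡.subst (λ m → HasCardinality (𝒱 e ε 2) (q ℕ.^ 5 ℕ.+ m ℕ.+ 1))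
    (ℕ.*-identityˡ (q ℕ.^ 2))
    (𝒱-card (μ-card-even (≡.trans (e≡ e%4≡1) (≡.cong suc j*4≡)) j ≡.refl))) ,
  (λ e%4≡3 →
    𝒱-card (μ-card-odd (≡.trans (e≡ e%4≡3) (≡.cong (3 ℕ.+_) j*4≡)) j ≡.refl))
  where
  open Hypersurface F finite

  E : QuadraticExtension F e
  E = record
    { 0<e     = ℕ.≤-trans (s≤s z≤n) 3≤e
    ; finite  = finite
    ; ε       = ε
    ; δ       = δ
    ; ε∉      = ε∉
    ; δ∈      = δ∈
    ; trace-δ = trace-δ
    ; ε-root  = ε-root
    }

  open Variety F e E

  j : ℕ
  j = e / 4

  e≡ : ∀ {r} → e % 4 ≡ r → e ≡ r ℕ.+ j ℕ.* 4
  e≡ ≡.refl = ℕ.m≡m%n+[m/n]*n e 4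

  j*4≡ : j ℕ.* 4 ≡ j ℕ.* 2 ℕ.* 2
  j*4≡ = ≡.sym (ℕ.*-assoc j 2 2)
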